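{- Let $\mathcal A=(a_1,\dots,a_n)$ be a full-dimensional point configuration in $\mathbb R^d$. Then each of the following determines each of the others: the set of sweep permutations $\Pi(\mathcal A)$, the poset of sweeps $\Sigma(\mathcal A)$, the sweep oriented matroid $\mathcal M(\mathcal A)$, and the big oriented matroid $\mathcal B(\mathcal A)$. Each of them determines the little oriented matroid $\mathcal L(\mathcal A)$, which does not always determine them (there exist configurations with the same little oriented matroid but different sets of sweep permutations).
   Context: For $u\in\mathbb R^d$, the sweep of $\mathcal A$ associated to $u$ is the ordered partition $(I_1,\dots,I_l)$ of $[n]$ such that $\langle u,a_i\rangle=\langle u,a_j\rangle$ for $i,j$ in the same block and $\langle u,a_i\rangle<\langle u,a_j\rangle$ if $i\in I_r$, $j\in I_s$, $r<s$. The poset of sweeps $\Sigma(\mathcal A)$ is the set of all sweeps ordered by refinement ($J$ refines $I$ if every block of $I$ is a union of consecutive blocks of $J$); its maximal elements are the sweep permutations $\Pi(\mathcal A)$. The oriented matroid of a vector configuration $(v_e)_{e\in E}$ in $\mathbb R^m$ has covectors $(\mathrm{sign}\langle u,v_e\rangle)_{e\in E}$ for $u\in\mathbb R^m$. With $\binom{[n]}{2}$ the set of pairs $(i,j)$, $i<j$: the little oriented matroid $\mathcal L(\mathcal A)$ is the oriented matroid on $[n]$ of the vectors $(a_i,1)\in\mathbb R^{d+1}$; the sweep oriented matroid $\mathcal M(\mathcal A)$ is the oriented matroid on $\binom{[n]}{2}$ of the vectors $a_j-a_i$; the big oriented matroid $\mathcal B(\mathcal A)$ is the oriented matroid on $[n]\cup\binom{[n]}{2}$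 of the vectors $(a_i,1)$, $i\in[n]$, and $(a_j-a_i,0)$, $(i,j)\in\binom{[n]}{2}$. -}

module Defs where

open import Level using (Level; _⊔_) renaming (suc to lsuc)
open import Data.Nat using (ℕ; zero; suc)
open import Data.Fin using (Fin; zero; suc) renaming (_<_ to _<ᶠ_)
open import Data.Fin.Subset using (Subset; _∈_; Nonempty; ⋃)
open import Data.List using (List; []; _∷_; _++_; length; lookup)
open import Data.Product using (Σ; Σ-syntax; ∃; ∃-syntax; _×_; _,_; proj₁; proj₂)
open import Data.Sum using (_⊎_; inj₁; inj₂)
open import Relation.Binary.PropositionalEquality using (_≡_; _≢_)
open import Relation.Binary.Structures using (IsStrictTotalOrder)
open import Algebra.Structures using (IsCommutativeRing)

-- An ordered field (with propositional equality as the field equality).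
-- ℝ is an instance; the theorem is stated for an arbitrary ordered field.
record OrderedField (c ℓ : Level) : Set (lsuc (c ⊔ ℓ)) where
  infixl 7 _*_
  infixl 6 _+_
  infix 8 -_
  infix 4 _<_
  field
    Carrier : Set c
    _+_ _*_ : Carrier → Carrier → Carrier
    -_ : Carrier → Carrier
    0# 1# : Carrier
    _<_ : Carrier → Carrier → Set ℓ
    isCommutativeRing : IsCommutativeRing _≡_ _+_ _*_ -_ 0# 1#
    0≢1 : 0# ≢ 1#
    inverse : ∀ x → x ≢ 0# → ∃[ y ] (x * y ≡ 1#)
    isStrictTotalOrder : IsStrictTotalOrder _≡_ _<_
    +-mono-< : ∀ {x y} z → x < y → x + z < y + z
    *-pos : ∀ {x y} → 0# < x → 0# < y → 0# < x * y

data Sign : Set where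
  neg zer pos : Sign

Pair : ℕ → Set
Pair n = Σ[ p ∈ Fin n × Fin n ] (proj₁ p <ᶠ proj₂ p)

OrdPart : ℕ → Set
OrdPart n = List (Subset n)

data Refines {n : ℕ} : OrdPart n → OrdPart n → Set where
  [] : Refines [] []
  seg : ∀ {J I} (B : Subset n) (Bs : List (Subset n)) →
        Refines J I → Refines ((B ∷ Bs) ++ J) (⋃ (B ∷ Bs) ∷ I)

module OF {c ℓ : Level} (K : OrderedField c ℓ) where
  open OrderedField K

  Vec : ℕ → Set c
  Vec m = Fin m → Carrier

  ⟨_,_⟩ : ∀ {m} → Vec m → Vec m → Carrier
  ⟨_,_⟩ {zero} u v = 0#
  ⟨_,_⟩ {suc m} u v = u zero * v zero + ⟨ (λ k → u (suc k)) , (λ k → v (suc k)) ⟩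

  _-ᵛ_ : ∀ {m} → Vec m → Vec m → Vec m
  (u -ᵛ v) k = u k + - v k

  -- (x , t) ∈ K^{m+1}; the extra coordinate is placed first (irrelevant for
  -- the oriented matroid).
  ext : ∀ {m} → Vec m → Carrier → Vec (suc m)
  ext x t zero = t
  ext x t (suc k) = x k

  Config : ℕ → ℕ → Set c
  Config n d = Fin n → Vec d

  -- full-dimensional: the affine span of the points is K^d, i.e. the vectors
  -- (a_i , 1) span K^{d+1}, i.e. no nonzero linear functional on K^{d+1}
  -- vanishes on all of them.
  FullDim : ∀ {n d} → Config n d → Set c
  FullDim {n} {d} A = ∀ (w : Vec (suc d)) → (∀ i → ⟨ w , ext (A i) 1# ⟩ ≡ 0#) → ∀ k → w k ≡ 0#

  HasSign : Carrier → Sign → Set (c ⊔ ℓ)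
  HasSign x neg = Level.Lift c (x < 0#)
  HasSign x zer = Level.Lift ℓ (x ≡ 0#)
  HasSign x pos = Level.Lift c (0# < x)

  Covector : ∀ {E : Set} {m} → (E → Vec m) → (E → Sign) → Set (c ⊔ ℓ)
  Covector {E} {m} v X = ∃[ u ] (∀ (e : E) → HasSign ⟨ u , v e ⟩ (X e))

  LittleOM : ∀ {n d} → Config n d → (Fin n → Sign) → Set (c ⊔ ℓ)
  LittleOM A = Covector (λ i → ext (A i) 1#)

  SweepOM : ∀ {n d} → Config n d → (Pair n → Sign) → Set (c ⊔ ℓ)
  SweepOM A = Covector (λ p → A (proj₂ (proj₁ p)) -ᵛ A (proj₁ (proj₁ p)))

  bigVec : ∀ {n d} → Config n d → Fin n ⊎ Pair n → Vec (suc d)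
  bigVec A (inj₁ i) = ext (A i) 1#
  bigVec A (inj₂ p) = ext (A (proj₂ (proj₁ p)) -ᵛ A (proj₁ (proj₁ p))) 0#

  BigOM : ∀ {n d} → Config n d → (Fin n ⊎ Pair n → Sign) → Set (c ⊔ ℓ)
  BigOM A = Covector (bigVec A)

  IsSweep : ∀ {n d} → Config n d → Vec d → OrdPart n → Set (c ⊔ ℓ)
  IsSweep {n} A u P =
    (∀ (r : Fin (length P)) → Nonempty (lookup P r)) ×
    (∀ (i : Fin n) → ∃[ r ] (i ∈ lookup P r)) ×
    (∀ (r : Fin (length P)) (i j : Fin n) → i ∈ lookup P r → j ∈ lookup P r →
       Level.Lift ℓ (⟨ u , A i ⟩ ≡ ⟨ u , A j ⟩)) ×
    (∀ (r s : Fin (length P)) (i j : Fin n) → r <ᶠ s → i ∈ lookup P r → j ∈ lookup P s →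
       Level.Lift c (⟨ u , A i ⟩ < ⟨ u , A j ⟩))

  -- the poset of sweeps Σ(A) (its order is refinement, `Refines`)
  Sweeps : ∀ {n d} → Config n d → OrdPart n → Set (c ⊔ ℓ)
  Sweeps A P = ∃[ u ] IsSweep A u P

  SweepPerms : ∀ {n d} → Config n d → OrdPart n → Set (c ⊔ ℓ)
  SweepPerms A P = Sweeps A P × (∀ Q → Sweeps A Q → Refines Q P → Q ≡ P)

{-# OPTIONS --safe #-}

-- A sweep of A records the order in which a functional u sees the points,
-- that is, the signs of all ⟨ u , aⱼ − aᵢ ⟩. Every one of Σ, M and B therefore
-- determines, and is determined by, the set of order types realized by A; for B
-- one also has to place the level −t of an affine functional ⟨ u , – ⟩ + t relative to the
-- points, which is possible in any configuration with the same order type. For Π, the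
-- sweep permutations are the topes of M, and the topes of an oriented matroid determine
-- its covectors: X is a covector as soon as the composition X ∙ T is a tope for every tope T.
-- For the last claim, a square and a trapezoid are projectively equivalent, so they have the
-- same little oriented matroid, but only the square has two pairs of parallel sides.
module Submission where

open import Defs
open import Algebra.Bundles using (CommutativeRing)
open import Algebra.Solver.Ring.AlmostCommutativeRing
  using (fromCommutativeRing; _-Raw-AlmostCommutative⟶_)
import Algebra.Properties.Ring
import Algebra.Properties.Semiring.Mult.TCOptimised
import Algebra.Solver.Ring
open import Data.Empty using (⊥-elim)
open import Data.Fin using (Fin; zero; suc; combine; remQuot) renaming (_<_ to _<ᶠ_)
open import Data.Fin.Properties as Fin using (any?; all?; remQuot-combine)
open import Data.Fin.Subset
  using (Subset; inside; outside; _∈_; _∉_; _⊂_; _∪_; _─_; ⁅_⁆; ⋃; Nonempty)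
  renaming (_⊆_ to _⊆ˢ_)
open import Data.Fin.Subset.Induction using (⊂-wellFounded; Acc; acc)
open import Data.Fin.Subset.Properties
  using (nonempty?; _∈?_; x∈⁅x⁆; x∈⁅y⁆⇒x≡y; x∈p∪q⁻; x∈p∪q⁺; ∉⊥; ⊆-antisym; ∪-identityʳ;
         p─q⊆p; x∈p∧x∉q⇒x∈p─q)
open import Data.Integer as ℤ using (ℤ; +_; -[1+_]; _⊖_)
open import Data.Integer.Properties as ℤ using ()
open import Data.List using (List; []; _∷_; allFin; length; lookup)
open import Data.List.Membership.Propositional using () renaming (_∈_ to _∈ˡ_)
open import Data.List.Membership.Propositional.Properties using (∈-allFin)
open import Data.List.Relation.Unary.Any using (here; there)
open import Data.Maybe using (Maybe; just; nothing)
open import Data.Nat as ℕ using (ℕ; zero; suc; z≤n; s≤s; z<s; s<s)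
open import Data.Nat.Properties as ℕ using ()
open import Data.Product using (Σ-syntax; ∃-syntax; _×_; _,_; proj₁; proj₂)
open import Data.Sum using (_⊎_; inj₁; inj₂; [_,_]′)
open import Data.Vec as V using (_∷_; here; there)
open import Data.Vec.Properties as V using ()
open import Function using (_∘_)
open import Function.Bundles using (_⇔_; mk⇔)
open import Level using (Level; _⊔_; lift; lower)
open import Relation.Binary.Definitions using (tri<; tri≈; tri>; DecidableEquality)
open import Relation.Binary.PropositionalEquality
  using (_≡_; _≢_; refl; sym; trans; cong; cong₂; subst; subst₂; module ≡-Reasoning)
open import Relation.Binary.Structures using (IsStrictTotalOrder)
open import Relation.Nullary using (¬_; Dec; yes; no; ¬?)
open import Relation.Nullary.Decidable using (_×-dec_; does; dec-true; decidable-stable)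
open import Relation.Unary using (_⊆_; _≐_)

-- Ring identities with integer coefficients.

-- The ring solver is run with coefficients in ℤ, because cancellation can
-- only be detected in a coefficient ring whose equality computes.
module IntegerSolver {c ℓ} (R : CommutativeRing c ℓ) where
  open CommutativeRing R hiding (_-_) renaming (refl to ≈-refl; sym to ≈-sym; trans to ≈-trans)
  open Algebra.Properties.Ring ring
  open Algebra.Properties.Semiring.Mult.TCOptimised semiring
    using (×-homo-+; ×1-homo-*; 1+×) renaming (_×_ to _·_)
  open import Relation.Binary.Reasoning.Setoid setoid

  ⟦_⟧ℤ : ℤ → Carrier
  ⟦ + n ⟧ℤ = n · 1#
  ⟦ -[1+ n ] ⟧ℤ = - (suc n · 1#)

  neg-homo : ∀ i → ⟦ ℤ.- i ⟧ℤ ≈ - ⟦ i ⟧ℤ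
  neg-homo (+ zero) = ≈-sym -0#≈0#
  neg-homo (+ suc n) = ≈-refl
  neg-homo -[1+ n ] = ≈-sym (-‿involutive _)

  ⊖-homo : ∀ m n → ⟦ m ⊖ n ⟧ℤ ≈ m · 1# + - (n · 1#)
  ⊖-homo zero zero = ≈-sym (-‿inverseʳ 0#)
  ⊖-homo zero (suc n) = ≈-sym (+-identityˡ _)
  ⊖-homo (suc m) zero = ≈-sym
    (≈-trans (+-congˡ -0#≈0#) (+-identityʳ _))
  ⊖-homo (suc m) (suc n) = begin
    ⟦ suc m ⊖ suc n ⟧ℤ                      ≡⟨ cong ⟦_⟧ℤ (ℤ.[1+m]⊖[1+n]≡m⊖n m n) ⟩
    ⟦ m ⊖ n ⟧ℤ                              ≈⟨ ⊖-homo m n ⟩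
    a + - b                                ≈⟨ +-congʳ (+-identityˡ a) ⟨
    (0# + a) + - b                         ≈⟨ +-congʳ (+-congʳ (-‿inverseʳ 1#)) ⟨
    ((1# + - 1#) + a) + - b                ≈⟨ +-congʳ (+-assoc _ _ _) ⟩
    (1# + (- 1# + a)) + - b                ≈⟨ +-congʳ (+-congˡ (+-comm _ _)) ⟩
    (1# + (a + - 1#)) + - b                ≈⟨ +-congʳ (+-assoc _ _ _) ⟨
    ((1# + a) + - 1#) + - b                ≈⟨ +-assoc _ _ _ ⟩
    (1# + a) + (- 1# + - b)                ≈⟨ +-congˡ (-‿+-comm 1# b) ⟩
    (1# + a) + - (1# + b)                  ≈⟨ +-cong (1+× m 1#) (-‿cong (1+× n 1#)) ⟨
    suc m · 1# + - (suc n · 1#)            ∎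
    where a = m · 1#
          b = n · 1#

  +-homo : ∀ i j → ⟦ i ℤ.+ j ⟧ℤ ≈ ⟦ i ⟧ℤ + ⟦ j ⟧ℤ
  +-homo (+ m) (+ n) = ×-homo-+ 1# m n
  +-homo (+ m) -[1+ n ] = ⊖-homo m (suc n)
  +-homo -[1+ m ] (+ n) =
    ≈-trans (⊖-homo n (suc m)) (+-comm _ _)
  +-homo -[1+ m ] -[1+ n ] = begin
    - (suc (suc (m ℕ.+ n)) · 1#)           ≡⟨ cong (λ k → - (suc k · 1#)) (ℕ.+-suc m n) ⟨
    - ((suc m ℕ.+ suc n) · 1#)             ≈⟨ -‿cong (×-homo-+ 1# (suc m) (suc n)) ⟩
    - (suc m · 1# + suc n · 1#)            ≈⟨ -‿+-comm _ _ ⟨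
    - (suc m · 1#) + - (suc n · 1#)        ∎

  *-homo-ℕ : ∀ m j → ⟦ + m ℤ.* j ⟧ℤ ≈ m · 1# * ⟦ j ⟧ℤ
  *-homo-ℕ m (+ n) = begin
    ⟦ + m ℤ.* + n ⟧ℤ                        ≡⟨ cong ⟦_⟧ℤ (ℤ.pos-* m n) ⟨
    (m ℕ.* n) · 1#                         ≈⟨ ×1-homo-* m n ⟩
    m · 1# * (n · 1#)                      ∎
  *-homo-ℕ m -[1+ n ] = begin
    ⟦ + m ℤ.* -[1+ n ] ⟧ℤ                   ≡⟨ cong ⟦_⟧ℤ (ℤ.neg-distribʳ-* (+ m) (+ suc n)) ⟨
    ⟦ ℤ.- (+ m ℤ.* + suc n) ⟧ℤ              ≈⟨ neg-homo (+ m ℤ.* + suc n) ⟩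
    - ⟦ + m ℤ.* + suc n ⟧ℤ                  ≈⟨ -‿cong (*-homo-ℕ m (+ suc n)) ⟩
    - (m · 1# * (suc n · 1#))              ≈⟨ -‿distribʳ-* _ _ ⟩
    m · 1# * - (suc n · 1#)                ∎

  *-homo : ∀ i j → ⟦ i ℤ.* j ⟧ℤ ≈ ⟦ i ⟧ℤ * ⟦ j ⟧ℤ
  *-homo (+ m) j = *-homo-ℕ m j
  *-homo -[1+ m ] j = begin
    ⟦ -[1+ m ] ℤ.* j ⟧ℤ                     ≡⟨ cong ⟦_⟧ℤ (ℤ.neg-distribˡ-* (+ suc m) j) ⟨
    ⟦ ℤ.- (+ suc m ℤ.* j) ⟧ℤ                ≈⟨ neg-homo (+ suc m ℤ.* j) ⟩
    - ⟦ + suc m ℤ.* j ⟧ℤ                    ≈⟨ -‿cong (*-homo-ℕ (suc m) j) ⟩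
    - (suc m · 1# * ⟦ j ⟧ℤ)                 ≈⟨ -‿distribˡ-* _ _ ⟩
    - (suc m · 1#) * ⟦ j ⟧ℤ                 ∎

  morphism : CommutativeRing.rawRing ℤ.+-*-commutativeRing
             -Raw-AlmostCommutative⟶ fromCommutativeRing R
  morphism = record
    { ⟦_⟧    = ⟦_⟧ℤ
    ; +-homo = +-homo
    ; *-homo = *-homo
    ; -‿homo = neg-homo
    ; 0-homo = ≈-refl
    ; 1-homo = ≈-refl
    }

  _coeff≟_ : ∀ i j → Maybe (⟦ i ⟧ℤ ≈ ⟦ j ⟧ℤ)
  i coeff≟ j with i ℤ.≟ j
  ... | yes i≡j = just (reflexive (cong ⟦_⟧ℤ i≡j))
  ... | no _ = nothing

  open Algebra.Solver.Ring (CommutativeRing.rawRing ℤ.+-*-commutativeRing)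
    (fromCommutativeRing R) morphism _coeff≟_ public

-- Ordered fields: signs, perturbation and separation.

module FieldProperties {c ℓ} (K : OrderedField c ℓ) where
  open OrderedField K
  open OF K using (HasSign)
  open IsStrictTotalOrder isStrictTotalOrder public
    using (compare; _≟_) renaming (trans to <-trans; irrefl to <-irrefl; asym to <-asym)

  commutativeRing : CommutativeRing c c
  commutativeRing = record { isCommutativeRing = isCommutativeRing }

  open CommutativeRing commutativeRing public
    using (+-identityˡ; +-identityʳ; *-identityˡ; *-identityʳ; -‿inverseʳ; zeroˡ; zeroʳ)
  open IntegerSolver commutativeRing public
    using (solve; con; _:=_; _:+_; _:*_; :-_; _:-_)

  <⇒0<- : ∀ {x y} → x < y → 0# < y + - x
  <⇒0<- {x} x<y = subst (_< _) (-‿inverseʳ x) (+-mono-< (- x) x<y)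

  0<-⇒< : ∀ {x y} → 0# < y + - x → x < y
  0<-⇒< {x} {y} 0<y-x = subst₂ _<_ (+-identityˡ x)
    (solve 2 (λ x y → (y :+ :- x) :+ x := y) refl x y) (+-mono-< x 0<y-x)

  0<x⇒-x<0 : ∀ {x} → 0# < x → - x < 0#
  0<x⇒-x<0 {x} 0<x = subst₂ _<_ (+-identityˡ _) (-‿inverseʳ x) (+-mono-< (- x) 0<x)

  x<0⇒0<-x : ∀ {x} → x < 0# → 0# < - x
  x<0⇒0<-x {x} x<0 = subst (0# <_) (+-identityˡ _) (<⇒0<- x<0)

  +-pos : ∀ {x y} → 0# < x → 0# < y → 0# < x + y
  +-pos {x} {y} 0<x 0<y =
    <-trans (subst (0# <_) (sym (+-identityˡ y)) 0<y) (+-mono-< y 0<x)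

  0<x*x : ∀ {x} → x ≢ 0# → 0# < x * x
  0<x*x {x} x≢0 with compare 0# x
  ... | tri< 0<x _ _ = *-pos 0<x 0<x
  ... | tri≈ _ 0≡x _ = ⊥-elim (x≢0 (sym 0≡x))
  ... | tri> _ _ x<0 = subst (0# <_) (solve 1 (λ x → :- x :* :- x := x :* x) refl x)
    (*-pos (x<0⇒0<-x x<0) (x<0⇒0<-x x<0))

  0<1 : 0# < 1#
  0<1 = subst (0# <_) (*-identityˡ 1#) (0<x*x λ 1≡0 → 0≢1 (sym 1≡0))

  2# : Carrier
  2# = 1# + 1#

  0<2 : 0# < 2#
  0<2 = +-pos 0<1 0<1

  x<x+1 : ∀ x → x < x + 1#
  x<x+1 x = 0<-⇒< (subst (0# <_) (solve 1 (λ x → con (+ 1) := (x :+ con (+ 1)) :+ :- x) refl x) 0<1)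

  opposite : Sign → Sign
  opposite neg = pos
  opposite zer = zer
  opposite pos = neg

  infixr 6 _∙_
  -- Applied entrywise, this is the composition of sign vectors from oriented matroid theory.
  _∙_ : Sign → Sign → Sign
  neg ∙ t = neg
  zer ∙ t = t
  pos ∙ t = pos

  sign : Carrier → Sign
  sign x with compare x 0#
  ... | tri< _ _ _ = neg
  ... | tri≈ _ _ _ = zer
  ... | tri> _ _ _ = pos

  hasSign : ∀ x → HasSign x (sign x)
  hasSign x with compare x 0#
  ... | tri< x<0 _ _ = lift x<0
  ... | tri≈ _ x≡0 _ = lift x≡0
  ... | tri> _ _ 0<x = lift 0<x

  sign-unique : ∀ {x} s → HasSign x s → sign x ≡ s
  sign-unique {x} s h with compare x 0#
  sign-unique neg h | tri< _ _ _ = refl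
  sign-unique zer (lift x≡0) | tri< _ x≢0 _ = ⊥-elim (x≢0 x≡0)
  sign-unique pos (lift 0<x) | tri< _ _ ≯ = ⊥-elim (≯ 0<x)
  sign-unique neg (lift x<0) | tri≈ ≮ _ _ = ⊥-elim (≮ x<0)
  sign-unique zer h | tri≈ _ _ _ = refl
  sign-unique pos (lift 0<x) | tri≈ _ _ ≯ = ⊥-elim (≯ 0<x)
  sign-unique neg (lift x<0) | tri> ≮ _ _ = ⊥-elim (≮ x<0)
  sign-unique zer (lift x≡0) | tri> _ x≢0 _ = ⊥-elim (x≢0 x≡0)
  sign-unique pos h | tri> _ _ _ = refl

  hasSign-resp : ∀ {x y s} → sign x ≡ sign y → HasSign x s → HasSign y s
  hasSign-resp {y = y} {s} eq h =
    subst (HasSign y) (trans (sym eq) (sign-unique s h)) (hasSign y)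

  sign-zero : ∀ {x} → x ≡ 0# → sign x ≡ zer
  sign-zero x≡0 = sign-unique zer (lift x≡0)

  zero-sign : ∀ {x} → sign x ≡ zer → x ≡ 0#
  zero-sign {x} eq = lower (subst (HasSign x) eq (hasSign x))

  sign-pos : ∀ {x} → 0# < x → sign x ≡ pos
  sign-pos 0<x = sign-unique pos (lift 0<x)

  pos-sign : ∀ {x} → sign x ≡ pos → 0# < x
  pos-sign {x} eq = lower (subst (HasSign x) eq (hasSign x))

  sign-neg : ∀ {x} → x < 0# → sign x ≡ neg
  sign-neg x<0 = sign-unique neg (lift x<0)

  neg-sign : ∀ {x} → sign x ≡ neg → x < 0#
  neg-sign {x} eq = lower (subst (HasSign x) eq (hasSign x))

  sign-- : ∀ x → sign (- x) ≡ opposite (sign x)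
  sign-- x with compare x 0#
  ... | tri< x<0 _ _ = sign-pos (x<0⇒0<-x x<0)
  ... | tri≈ _ x≡0 _ = sign-zero (trans (cong -_ x≡0) (solve 0 (:- con (+ 0) := con (+ 0)) refl))
  ... | tri> _ _ 0<x = sign-neg (0<x⇒-x<0 0<x)

  sign-* : ∀ {a} x → 0# < a → sign (a * x) ≡ sign x
  sign-* {a} x 0<a with compare x 0#
  ... | tri< x<0 _ _ = sign-neg (subst (_< 0#)
          (solve 2 (λ a x → :- (a :* :- x) := a :* x) refl a x)
          (0<x⇒-x<0 (*-pos 0<a (x<0⇒0<-x x<0))))
  ... | tri≈ _ x≡0 _ = sign-zero (trans (cong (a *_) x≡0) (zeroʳ a))
  ... | tri> _ _ 0<x = sign-pos (*-pos 0<a 0<x)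

  sign-+ : ∀ {x y} s → sign x ≡ s → sign y ≡ s → sign (x + y) ≡ s
  sign-+ {x} {y} neg x<0 y<0 = sign-neg (subst (_< 0#)
    (solve 2 (λ x y → :- (:- x :+ :- y) := x :+ y) refl x y)
    (0<x⇒-x<0 (+-pos (x<0⇒0<-x (neg-sign x<0)) (x<0⇒0<-x (neg-sign y<0)))))
  sign-+ zer x≡0 y≡0 = sign-zero (trans (cong₂ _+_ (zero-sign x≡0) (zero-sign y≡0)) (+-identityˡ 0#))
  sign-+ pos 0<x 0<y = sign-pos (+-pos (pos-sign 0<x) (pos-sign 0<y))

  sign-combination : ∀ {a b x y} s → 0# < a → 0# < b → sign x ≡ s → sign y ≡ s →
                     sign (a * x + b * y) ≡ s
  sign-combination s 0<a 0<b x∼s y∼s =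
    sign-+ s (trans (sign-* _ 0<a) x∼s) (trans (sign-* _ 0<b) y∼s)

  -- The coefficients are the absolute values of `y` and `x`: for opposite signs, |y| x + |x| y = 0.
  cancel : ∀ {x y} → x ≢ 0# → sign y ≡ opposite (sign x) →
           Σ[ a ∈ Carrier ] Σ[ b ∈ Carrier ] 0# < a × 0# < b × a * x + b * y ≡ 0#
  cancel {x} {y} x≢0 y∼-x with compare x 0#
  ... | tri< x<0 _ _ = y , - x , pos-sign y∼-x , x<0⇒0<-x x<0 ,
    solve 2 (λ x y → y :* x :+ :- x :* y := con (+ 0)) refl x y
  ... | tri≈ _ x≡0 _ = ⊥-elim (x≢0 x≡0)
  ... | tri> _ _ 0<x = - y , x , x<0⇒0<-x (neg-sign y∼-x) , 0<x ,
    solve 2 (λ x y → :- y :* x :+ x :* y := con (+ 0)) refl x y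

  -- As `i` is the inverse of `y`, the sum factors as (m + w i) y, and the bound on `m` makes the
  -- first factor positive.
  sign-dominated : ∀ {m y i} w → y * i ≡ 1# → - (w * i) < m → sign (m * y + w) ≡ sign y
  sign-dominated {m} {y} {i} w y*i≡1 t<m = trans (cong sign factor) (sign-* y positive)
    where
    open ≡-Reasoning
    factor : m * y + w ≡ (m + w * i) * y
    factor = begin
      m * y + w              ≡⟨ cong (λ o → m * y + o) (*-identityʳ w) ⟨
      m * y + w * 1#         ≡⟨ cong (λ o → m * y + w * o) y*i≡1 ⟨
      m * y + w * (y * i)    ≡⟨ solve 4 (λ m w y i →
        m :* y :+ w :* (y :* i) := (m :+ w :* i) :* y) refl m w y i ⟩
      (m + w * i) * y        ∎
    positive : 0# < m + w * i
    positive = subst (0# <_)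
      (solve 3 (λ m w i → m :+ :- (:- (w :* i)) := m :+ w :* i) refl m w i) (<⇒0<- t<m)

  -- Instead of adding a small multiple of `w`, `y` is scaled by a large `m`. Every condition is
  -- then a lower bound on `m`, so finitely many of them can be met at once with `bound`.
  sign-perturb : ∀ y w → ∃[ t ] (∀ {m} → t < m → sign (m * y + w) ≡ sign y ∙ sign w)
  sign-perturb y w with compare y 0#
  -- The threshold is arbitrary here: the sum is `w` for every `m`.
  ... | tri≈ _ y≡0 _ = 0# , λ {m} _ → cong sign (trans
          (cong (λ z → m * z + w) y≡0) (solve 2 (λ m w → m :* con (+ 0) :+ w := w) refl m w))
  ... | tri< y<0 y≢0 _ = - (w * inverse y y≢0 .proj₁) , λ t<m →
          trans (sign-dominated w (inverse y y≢0 .proj₂) t<m) (sign-neg y<0)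
  ... | tri> _ y≢0 0<y = - (w * inverse y y≢0 .proj₁) , λ t<m →
          trans (sign-dominated w (inverse y y≢0 .proj₂) t<m) (sign-pos 0<y)

  inverse-pos : ∀ {x y} → 0# < x → x * y ≡ 1# → 0# < y
  inverse-pos {x} {y} 0<x xy≡1 =
    pos-sign (trans (sym (sign-* y 0<x)) (trans (cong sign xy≡1) (sign-pos 0<1)))

  bound : ∀ {n} (t : Fin n → Carrier) → ∃[ m ] (∀ i → t i < m)
  bound {zero} t = 0# , λ ()
  bound {suc n} t with bound (λ i → t (suc i))
  ... | m , t<m with compare m (t zero + 1#)
  ...   | tri< m<m′ _ _ = t zero + 1# , λ { zero → x<x+1 _ ; (suc i) → <-trans (t<m i) m<m′ }
  ...   | tri≈ _ refl _ = m , λ { zero → x<x+1 _ ; (suc i) → t<m i }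
  ...   | tri> _ _ m′<m = m , λ { zero → <-trans (x<x+1 _) m′<m ; (suc i) → t<m i }

  dense : ∀ {x y} → x < y → ∃[ z ] (x < z × z < y)
  dense {x} {y} x<y with inverse 2# (λ 2≡0 → <-irrefl (sym 2≡0) 0<2)
  -- The midpoint, with `h` one half and `d` the length of the interval.
  ... | h , 2h≡1 = x + h * d ,
      0<-⇒< (subst (0# <_) (solve 2 (λ x e → e := (x :+ e) :+ :- x) refl x (h * d)) 0<hd) ,
      0<-⇒< (subst (0# <_) (sym upper) 0<hd)
    where
    open ≡-Reasoning
    d = y + - x
    0<hd : 0# < h * d
    0<hd = *-pos (inverse-pos 0<2 2h≡1) (<⇒0<- x<y)
    upper : y + - (x + h * d) ≡ h * d
    upper = begin
      y + - (x + h * d)                   ≡⟨ solve 3 (λ x y h →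
        y :+ :- (x :+ h :* (y :+ :- x))
          := con (+ 1) :* (y :+ :- x) :+ :- (h :* (y :+ :- x))) refl x y h ⟩
      1# * d + - (h * d)                  ≡⟨ cong (λ o → o * d + - (h * d)) 2h≡1 ⟨
      2# * h * d + - (h * d)              ≡⟨ solve 2 (λ h d →
        con (+ 2) :* h :* d :+ :- (h :* d) := h :* d) refl h d ⟩
      h * d                               ∎

  infix 4 _≤_
  _≤_ : Carrier → Carrier → Set _
  x ≤ y = ¬ y < x

  ≤-<-trans : ∀ {x y z} → x ≤ y → y < z → x < z
  ≤-<-trans {x} {y} y≮x y<z with compare x y
  ... | tri< x<y _ _ = <-trans x<y y<z
  ... | tri≈ _ refl _ = y<z
  ... | tri> _ _ y<x = ⊥-elim (y≮x y<x)

  -- The witness is the maximum of `x` and the values of `f` on `P`. Including `x` gives a meaning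
  -- to the empty case, which is why `s` is compared only with those `y` that exceed `x`.
  supremum : ∀ {n p} {P : Fin n → Set p} (f : Fin n → Carrier) → (∀ i → Dec (P i)) → ∀ x →
             ∃[ s ] ((∀ i → P i → f i ≤ s) × (∀ {y} → x < y → (∀ i → P i → f i < y) → s < y))
  supremum {zero} f P? x = x , (λ ()) , λ x<y _ → x<y
  supremum {suc n} f P? x with supremum (λ i → f (suc i)) (λ i → P? (suc i)) x
  ... | s , f≤s , least with P? zero
  ...   | no ¬p = s , (λ { zero p → ⊥-elim (¬p p) ; (suc i) → f≤s i }) ,
            λ x<y f<y → least x<y λ i → f<y (suc i)
  ...   | yes p with compare s (f zero)
  ...     | tri< s<f _ _ = f zero ,
              (λ { zero _ → <-irrefl refl ; (suc i) q f<fi → f≤s i q (<-trans s<f f<fi) }) ,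
              λ _ f<y → f<y zero p
  ...     | tri≈ s≮f _ _ = s , (λ { zero _ → s≮f ; (suc i) → f≤s i }) ,
              λ x<y f<y → least x<y λ i → f<y (suc i)
  ...     | tri> s≮f _ _ = s , (λ { zero _ → s≮f ; (suc i) → f≤s i }) ,
              λ x<y f<y → least x<y λ i → f<y (suc i)

  neg-anti : ∀ {x y} → x < y → - y < - x
  neg-anti {x} {y} x<y = 0<-⇒< (subst (0# <_)
    (solve 2 (λ x y → y :+ :- x := :- x :+ :- (:- y)) refl x y) (<⇒0<- x<y))

  neg-anti⁻ : ∀ {x y} → - y < - x → x < y
  neg-anti⁻ {x} {y} -y<-x = 0<-⇒< (subst (0# <_)
    (solve 2 (λ x y → :- x :+ :- (:- y) := y :+ :- x) refl x y) (<⇒0<- -y<-x))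

  -- A point is chosen between the maximum `s` over `P` and the minimum over `Q`, the latter
  -- obtained as a maximum of negatives. The defaults cover empty classes: `- m` lies below all
  -- values of `f`, and `s + 1#` takes part in the minimum over `Q`.
  separate : ∀ {n p q} {P : Fin n → Set p} {Q : Fin n → Set q} (f : Fin n → Carrier) →
             (∀ i → Dec (P i)) → (∀ i → Dec (Q i)) → (∀ {i j} → P i → Q j → f i < f j) →
             ∃[ t ] ((∀ i → P i → f i < t) × (∀ j → Q j → t < f j))
  separate f P? Q? P<Q =
    let m , -f<m = bound (λ i → - f i)
        s , f≤s , s-least = supremum f P? (- m)
        s<f = λ j q → s-least
          (neg-anti⁻ (subst (- f j <_) (solve 1 (λ m → m := :- (:- m)) refl m) (-f<m j)))
          λ i p → P<Q p q
        i , -f≤i , i-least = supremum (λ j → - f j) Q? (- (s + 1#))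
        i<-s = i-least (neg-anti (x<x+1 s)) λ j q → neg-anti (s<f j q)
        t , i<t , t<-s = dense i<-s
        t≡--t = solve 1 (λ t → t := :- (:- t)) refl t
    in - t ,
       (λ j p → ≤-<-trans (f≤s j p) (neg-anti⁻ (subst (_< - s) t≡--t t<-s))) ,
       (λ j q → neg-anti⁻ (≤-<-trans (-f≤i j q) (subst (i <_) t≡--t i<t)))

_≟ˢ_ : DecidableEquality Sign
neg ≟ˢ neg = yes refl
neg ≟ˢ zer = no λ ()
neg ≟ˢ pos = no λ ()
zer ≟ˢ neg = no λ ()
zer ≟ˢ zer = yes refl
zer ≟ˢ pos = no λ ()
pos ≟ˢ neg = no λ ()
pos ≟ˢ zer = no λ ()
pos ≟ˢ pos = yes refl

-- Covectors of a vector configuration, and their reconstruction from topes.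

module Covectors {c ℓ} (K : OrderedField c ℓ) where
  open OrderedField K
  open OF K
  open FieldProperties K

  0ᵛ : ∀ {m} → Vec m
  0ᵛ _ = 0#

  lin : ∀ {m} → Carrier → Vec m → Carrier → Vec m → Vec m
  lin a u b w k = a * u k + b * w k

  ⟨lin,⟩ : ∀ {m} a (u : Vec m) b w v → ⟨ lin a u b w , v ⟩ ≡ a * ⟨ u , v ⟩ + b * ⟨ w , v ⟩
  ⟨lin,⟩ {zero} a u b w v = solve 2 (λ a b → con (+ 0) := a :* con (+ 0) :+ b :* con (+ 0)) refl a b
  ⟨lin,⟩ {suc m} a u b w v = trans
    (cong (λ r → (a * u zero + b * w zero) * v zero + r)
      (⟨lin,⟩ a (λ k → u (suc k)) b (λ k → w (suc k)) (λ k → v (suc k))))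
    (solve 7 (λ a u b w v p q → (a :* u :+ b :* w) :* v :+ (a :* p :+ b :* q)
                             := a :* (u :* v :+ p) :+ b :* (w :* v :+ q)) refl
       a (u zero) b (w zero) (v zero) _ _)

  ⟨0,⟩ : ∀ {m} (v : Vec m) → ⟨ 0ᵛ , v ⟩ ≡ 0#
  ⟨0,⟩ {zero} v = refl
  ⟨0,⟩ {suc m} v = trans (cong₂ _+_ (zeroˡ _) (⟨0,⟩ (λ k → v (suc k)))) (+-identityˡ 0#)

  ⟨,0⟩ : ∀ {m} (u v : Vec m) → (∀ k → v k ≡ 0#) → ⟨ u , v ⟩ ≡ 0#
  ⟨,0⟩ {zero} u v v≡0 = refl
  ⟨,0⟩ {suc m} u v v≡0 = trans
    (cong₂ _+_ (trans (cong (u zero *_) (v≡0 zero)) (zeroʳ _))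
      (⟨,0⟩ (λ k → u (suc k)) _ λ k → v≡0 (suc k)))
    (+-identityˡ 0#)

  ⟨,-⟩ : ∀ {m} (u v w : Vec m) → ⟨ u , v -ᵛ w ⟩ ≡ ⟨ u , v ⟩ + - ⟨ u , w ⟩
  ⟨,-⟩ {zero} u v w = solve 0 (con (+ 0) := con (+ 0) :+ :- con (+ 0)) refl
  ⟨,-⟩ {suc m} u v w = trans
    (cong (λ r → u zero * (v zero + - w zero) + r)
      (⟨,-⟩ (λ k → u (suc k)) (λ k → v (suc k)) (λ k → w (suc k))))
    (solve 5 (λ u v w p q → u :* (v :+ :- w) :+ (p :+ :- q)
                         := (u :* v :+ p) :+ :- (u :* w :+ q)) refl
       (u zero) (v zero) (w zero) _ _)

  ⟨v,v⟩-definite : ∀ {m} (v : Vec m) → (∀ k → v k ≡ 0#) ⊎ 0# < ⟨ v , v ⟩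
  ⟨v,v⟩-definite {zero} v = inj₁ λ ()
  ⟨v,v⟩-definite {suc m} v with v zero ≟ 0# | ⟨v,v⟩-definite (λ k → v (suc k))
  ... | yes v₀≡0 | inj₁ v≡0 = inj₁ λ { zero → v₀≡0 ; (suc k) → v≡0 k }
  ... | yes v₀≡0 | inj₂ 0<vv = inj₂ (subst (0# <_)
          (sym (trans (cong₂ _+_ (trans (cong (_* v zero) v₀≡0) (zeroˡ (v zero))) refl)
            (+-identityˡ _))) 0<vv)
  ... | no v₀≢0 | inj₁ v≡0 = inj₂ (subst (0# <_)
          (sym (trans (cong (λ r → v zero * v zero + r) (⟨,0⟩ _ _ v≡0)) (+-identityʳ _))) (0<x*x v₀≢0))
  ... | no v₀≢0 | inj₂ 0<vv = inj₂ (+-pos (0<x*x v₀≢0) 0<vv)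

  -- By definiteness a nonzero vector, used as a functional, does not vanish on itself; this
  -- supplies the directions in which to perturb.
  ⟨v,v⟩-sign : ∀ {m} (v : Vec m) → sign ⟨ v , v ⟩ ≡ zer → ∀ k → v k ≡ 0#
  ⟨v,v⟩-sign v vv≡0 with ⟨v,v⟩-definite v
  ... | inj₁ v≡0 = v≡0
  ... | inj₂ 0<vv = ⊥-elim (<-irrefl (sym (zero-sign vv≡0)) 0<vv)

  σ : ∀ {E : Set} {m} → (E → Vec m) → Vec m → E → Sign
  σ v u e = sign ⟨ u , v e ⟩

  ∙-assoc : ∀ r s t → (r ∙ s) ∙ t ≡ r ∙ (s ∙ t)
  ∙-assoc neg s t = refl
  ∙-assoc zer s t = refl
  ∙-assoc pos s t = refl

  ∙-nonzeroˡ : ∀ {s} t → s ≢ zer → s ∙ t ≡ s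
  ∙-nonzeroˡ {neg} t s≢0 = refl
  ∙-nonzeroˡ {zer} t s≢0 = ⊥-elim (s≢0 refl)
  ∙-nonzeroˡ {pos} t s≢0 = refl

  ∙-zeroˡ : ∀ s {t} → s ∙ t ≡ zer → s ≡ zer
  ∙-zeroˡ zer _ = refl

  ∙-zeroʳ : ∀ s {t} → s ∙ t ≡ zer → t ≡ zer
  ∙-zeroʳ zer t≡0 = t≡0

  ∙-identityʳ : ∀ s → s ∙ zer ≡ s
  ∙-identityʳ neg = refl
  ∙-identityʳ zer = refl
  ∙-identityʳ pos = refl

  opposite-zero : ∀ s → opposite s ≡ zer → s ≡ zer
  opposite-zero zer _ = refl

  -- Covectors are closed under composition: m u + w realizes the composition once `m` exceeds the
  -- thresholds of all elements.
  perturb : ∀ {N m} (v : Fin N → Vec m) u w → ∃[ z ] (∀ e → σ v z e ≡ σ v u e ∙ σ v w e)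
  perturb v u w with bound (λ e → sign-perturb ⟨ u , v e ⟩ ⟨ w , v e ⟩ .proj₁)
  ... | m , t<m = lin m u 1# w , λ e → trans
    (cong sign (trans (⟨lin,⟩ m u 1# w (v e)) (cong (λ r → m * ⟨ u , v e ⟩ + r) (*-identityˡ _))))
    (sign-perturb ⟨ u , v e ⟩ ⟨ w , v e ⟩ .proj₂ (t<m e))

  negᵛ : ∀ {m} → Vec m → Vec m
  negᵛ u = lin (- 1#) u 0# u

  σ-neg : ∀ {E : Set} {m} (v : E → Vec m) u e → σ v (negᵛ u) e ≡ opposite (σ v u e)
  σ-neg v u e = trans (cong sign (trans (⟨lin,⟩ (- 1#) u 0# u (v e))
    (solve 1 (λ x → :- con (+ 1) :* x :+ con (+ 0) :* x := :- x) refl ⟨ u , v e ⟩))) (sign-- _)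

  -- The functionals realizing topes: they vanish only on loops, the elements whose vector is zero.
  Generic : ∀ {E : Set} {m} → (E → Vec m) → Vec m → Set c
  Generic v u = ∀ e → σ v u e ≡ zer → ∀ k → v e k ≡ 0#

  zeros : ∀ {N m} → (Fin N → Vec m) → Vec m → Subset N
  zeros v u = V.tabulate λ e → does (σ v u e ≟ˢ zer)

  ∈zeros : ∀ {N m} {v : Fin N → Vec m} {u e} → σ v u e ≡ zer → e ∈ zeros v u
  ∈zeros {e = e} eq = V.lookup⇒[]= e _ (trans (V.lookup∘tabulate _ e) (dec-true (_ ≟ˢ zer) eq))

  zeros∋ : ∀ {N m} {v : Fin N → Vec m} {u e} → e ∈ zeros v u → σ v u e ≡ zer
  zeros∋ {v = v} {u} {e} e∈
    with σ v u e ≟ˢ zer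
       | trans (sym (V.lookup∘tabulate (λ e → does (σ v u e ≟ˢ zer)) e)) (V.[]=⇒lookup e∈)
  ... | yes eq | _ = eq
  ... | no _ | ()

  -- The convexity argument showing that a sign vector s is a covector as
  -- soon as all compositions of s with topes are: whenever u is not a tope, move it
  -- off its zeros in two opposite directions z and −z, and cancel an
  -- entry between the realizations of the two compositions.
  module Composition {N m} (v : Fin N → Vec m) (s : Fin N → Sign)
    (tope : ∀ u → Generic v u → ∃[ z ] (∀ e → σ v z e ≡ s e ∙ σ v u e)) where

    module Step (u : Vec m)
      (rec : ∀ w → zeros v w ⊂ zeros v u → ∃[ z ] (∀ e → σ v z e ≡ s e ∙ σ v w e)) where

      X : Fin N → Sign
      X e = s e ∙ σ v u e

      -- Perturbing `u` towards `w` creates no new zeros and removes the zero at `e`, so `rec`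
      -- applies to the perturbed functional; associativity of `∙` then regroups the signs.
      move : ∀ w e → σ v u e ≡ zer → σ v w e ≢ zer → ∃[ z ] (∀ e → σ v z e ≡ X e ∙ σ v w e)
      move w e ue≡0 we≢0 with perturb v u w
      ... | w′ , w′≡ with rec w′ (zeros⊆ , e , ∈zeros {v = v} ue≡0 , e∉)
        where
        zeros⊆ : ∀ {f} → f ∈ zeros v w′ → f ∈ zeros v u
        zeros⊆ {f} f∈ = ∈zeros {v = v} (∙-zeroˡ (σ v u f) (trans (sym (w′≡ f)) (zeros∋ {v = v} f∈)))
        e∉ : e ∉ zeros v w′
        e∉ e∈ = we≢0 (∙-zeroʳ (σ v u e) (trans (sym (w′≡ e)) (zeros∋ {v = v} e∈)))
      ... | z , z≡ = z , λ f → trans (z≡ f) (trans (cong (s f ∙_) (w′≡ f)) (sym (∙-assoc (s f) _ _)))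

      Agrees : Vec m → Set
      Agrees z = ∀ e → X e ≢ zer → σ v z e ≡ X e

      -- The zeros of `X` are treated one at a time. If `y` is nonzero at such an `f`, `move` along
      -- `- y` yields an `x` that agrees with `X` on its support and with `- y` off it. A positive
      -- combination of `y` and `x` that cancels at `f` keeps the support correct and keeps the
      -- zeros already obtained.
      eliminate : ∀ z → Agrees z → (fs : List (Fin N)) →
                  ∃[ z ] (Agrees z × (∀ {e} → e ∈ˡ fs → X e ≡ zer → σ v z e ≡ zer))
      eliminate z agrees [] = z , agrees , λ ()
      eliminate z agrees (f ∷ fs) with eliminate z agrees fs
      ... | y , y-agrees , y-zero with X f ≟ˢ zer | σ v y f ≟ˢ zer
      ...   | no Xf≢0 | _ = y , y-agrees ,
                λ { (here refl) Xf≡0 → ⊥-elim (Xf≢0 Xf≡0) ; (there e∈) → y-zero e∈ }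
      ...   | yes _ | yes yf≡0 = y , y-agrees , λ { (here refl) _ → yf≡0 ; (there e∈) → y-zero e∈ }
      ...   | yes Xf≡0 | no yf≢0
              with move (negᵛ y) f (∙-zeroʳ (s f) Xf≡0)
                     (λ eq → yf≢0 (opposite-zero _ (trans (sym (σ-neg v y f)) eq)))
      ...     | x , x≡ with cancel {⟨ y , v f ⟩} {⟨ x , v f ⟩} (λ eq → yf≢0 (sign-zero eq))
                              (trans (x≡ f) (trans (cong (_∙ _) Xf≡0) (σ-neg v y f)))
      ...       | a , b , 0<a , 0<b , cancels = lin a y b x , agree , zero′
        where
        value : ∀ e → σ v (lin a y b x) e ≡ sign (a * ⟨ y , v e ⟩ + b * ⟨ x , v e ⟩)
        value e = cong sign (⟨lin,⟩ a y b x (v e))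
        agree : Agrees (lin a y b x)
        agree e Xe≢0 = trans (value e) (sign-combination (X e) 0<a 0<b (y-agrees e Xe≢0)
          (trans (x≡ e) (∙-nonzeroˡ _ Xe≢0)))
        zero′ : ∀ {e} → e ∈ˡ f ∷ fs → X e ≡ zer → σ v (lin a y b x) e ≡ zer
        zero′ (here refl) _ = trans (value f) (sign-zero cancels)
        zero′ {e} (there e∈) Xe≡0 = trans (value e) (sign-combination zer 0<a 0<b (y-zero e∈ Xe≡0)
          (trans (x≡ e) (trans (cong (_∙ _) Xe≡0)
            (trans (σ-neg v y e) (cong opposite (y-zero e∈ Xe≡0))))))

      from-move : ∀ w e → σ v u e ≡ zer → σ v w e ≢ zer → ∃[ z ] (∀ e → σ v z e ≡ X e)
      from-move w e ue≡0 we≢0 with move w e ue≡0 we≢0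
      ... | y , y≡ with eliminate y (λ e Xe≢0 → trans (y≡ e) (∙-nonzeroˡ _ Xe≢0)) (allFin N)
      ...   | z , agrees , zero′ = z , realizes
        where
        realizes : ∀ e → σ v z e ≡ X e
        realizes e with X e ≟ˢ zer
        ... | yes Xe≡0 = trans (zero′ (∈-allFin e) Xe≡0) (sym Xe≡0)
        ... | no Xe≢0 = agrees e Xe≢0

    compose : ∀ u → Acc _⊂_ (zeros v u) → ∃[ z ] (∀ e → σ v z e ≡ s e ∙ σ v u e)
    compose u (acc rec) with any? (λ e → (σ v u e ≟ˢ zer) ×-dec ¬? (all? λ k → v e k ≟ 0#))
    -- Here `u` vanishes on the non-loop `e`, and the vector `v e` itself serves as the direction
    -- leaving that zero.
    ... | yes (e , ue≡0 , ve≢0) = Step.from-move u (λ w w⊂u → compose w (rec w⊂u))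
            (v e) e ue≡0 λ eq → ve≢0 (⟨v,v⟩-sign (v e) eq)
    ... | no none = tope u λ e ue≡0 → decidable-stable (all? λ k → v e k ≟ 0#)
            λ ve≢0 → none (e , ue≡0 , ve≢0)

    covector : ∃[ z ] (∀ e → σ v z e ≡ s e)
    -- The zero functional has only zero signs, so composing with it gives back `s`.
    covector with compose 0ᵛ (⊂-wellFounded _)
    ... | z , z≡ = z , λ e → trans (z≡ e)
            (trans (cong (s e ∙_) (sign-zero (⟨0,⟩ (v e)))) (∙-identityʳ (s e)))

  -- If X is a covector of v and T a tope of v′, then X ∙ T is a tope of v, as
  -- topes are common to v and v′, and hence a tope of v′.
  topes-determine-covectors : ∀ {N m m′} (v : Fin N → Vec m) (v′ : Fin N → Vec m′) →
    (∀ u → Generic v u → ∃[ u′ ] (Generic v′ u′ × (∀ e → σ v u e ≡ σ v′ u′ e))) →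
    (∀ u′ → Generic v′ u′ → ∃[ u ] (Generic v u × (∀ e → σ v′ u′ e ≡ σ v u e))) →
    ∀ x → ∃[ x′ ] (∀ e → σ v x e ≡ σ v′ x′ e)
  topes-determine-covectors v v′ to from x =
    let x′ , x′≡ = Composition.covector v′ (σ v x) tope in x′ , λ e → sym (x′≡ e)
    where
    tope : ∀ u′ → Generic v′ u′ → ∃[ z′ ] (∀ e → σ v′ z′ e ≡ σ v x e ∙ σ v′ u′ e)
    tope u′ u′-generic =
      let u , u-generic , u′≡u = from u′ u′-generic
          y , y≡ = perturb v x u
          -- A zero of the composition is a zero of `u`, hence a loop, so `y` is again generic.
          z′ , _ , y≡z′ = to y λ e ye≡0 → u-generic e (∙-zeroʳ (σ v x e) (trans (sym (y≡ e)) ye≡0))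
      in z′ , λ e → trans (sym (y≡z′ e)) (trans (y≡ e) (cong (σ v x e ∙_) (sym (u′≡u e))))

-- Subsets and unions of blocks.

p∪[q─p]≡q : ∀ {n} {p q : Subset n} → p ⊆ˢ q → p ∪ (q ─ p) ≡ q
p∪[q─p]≡q {p = p} {q} p⊆q = ⊆-antisym ([ p⊆q , p─q⊆p q p ]′ ∘ x∈p∪q⁻ p (q ─ p)) ⊇
  where
  ⊇ : q ⊆ˢ p ∪ (q ─ p)
  ⊇ {x} x∈q with x ∈? p
  ... | yes x∈p = x∈p∪q⁺ (inj₁ x∈p)
  ... | no x∉p = x∈p∪q⁺ (inj₂ (x∈p∧x∉q⇒x∈p─q x∈q x∉p))

x∈p─q⇒x∉q : ∀ {n} (p q : Subset n) {x} → x ∈ p ─ q → x ∉ q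
x∈p─q⇒x∉q (_ ∷ p) (inside ∷ q) (there x∈) (there x∈q) = x∈p─q⇒x∉q p q x∈ x∈q
x∈p─q⇒x∉q (_ ∷ p) (outside ∷ q) (there x∈) (there x∈q) = x∈p─q⇒x∉q p q x∈ x∈q

∈-lookup⇒∈-⋃ : ∀ {n} (P : OrdPart n) r {i} → i ∈ lookup P r → i ∈ ⋃ P
∈-lookup⇒∈-⋃ (B ∷ P) zero i∈B = x∈p∪q⁺ (inj₁ i∈B)
∈-lookup⇒∈-⋃ (B ∷ P) (suc r) i∈ = x∈p∪q⁺ (inj₂ (∈-lookup⇒∈-⋃ P r i∈))

∈-⋃⇒∈-lookup : ∀ {n} (P : OrdPart n) {i} → i ∈ ⋃ P → ∃[ r ] (i ∈ lookup P r)
∈-⋃⇒∈-lookup [] i∈ = ⊥-elim (∉⊥ i∈)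
∈-⋃⇒∈-lookup (B ∷ P) i∈ with x∈p∪q⁻ B (⋃ P) i∈
... | inj₁ i∈B = zero , i∈B
... | inj₂ i∈P with ∈-⋃⇒∈-lookup P i∈P
...   | r , i∈r = suc r , i∈r

-- Ordered partitions sorted by a function, and their refinement.

module OrderedPartitions {c ℓ} (K : OrderedField c ℓ) where
  open OrderedField K
  open OF K
  open FieldProperties K using (compare; <-irrefl; <-asym; <-trans)

  -- An inductive form of the sweep condition with `⋃ P` as ground set, so that tails are again
  -- sorted partitions.
  data Sorted {n} (f : Fin n → Carrier) : OrdPart n → Set (c ⊔ ℓ) where
    []  : Sorted f []
    cons : ∀ {B P} → Nonempty B → (∀ {i j} → i ∈ B → j ∈ B → f i ≡ f j) →
           (∀ {i j} → i ∈ B → j ∈ ⋃ P → f i < f j) → Sorted f P → Sorted f (B ∷ P)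

  -- One element `b` of the first block represents its value. The last component, that only `i` is
  -- new, ensures that a block in front stays below the enlarged tail.
  insert : ∀ {n} {f : Fin n → Carrier} i {P} → Sorted f P →
           Σ[ P′ ∈ OrdPart n ] (Sorted f P′ × i ∈ ⋃ P′ × ⋃ P ⊆ˢ ⋃ P′ ×
                      (∀ {j} → j ∈ ⋃ P′ → j ≡ i ⊎ j ∈ ⋃ P))
  insert {f = f} i [] = ⁅ i ⁆ ∷ [] ,
    cons (i , x∈⁅x⁆ i) (λ j∈ k∈ → cong f (trans (x∈⁅y⁆⇒x≡y i j∈) (sym (x∈⁅y⁆⇒x≡y i k∈))))
      (λ _ j∈ → ⊥-elim (∉⊥ j∈)) [] ,
    x∈p∪q⁺ (inj₁ (x∈⁅x⁆ i)) , (λ j∈ → ⊥-elim (∉⊥ j∈)) ,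
    λ j∈ → [ inj₁ ∘ x∈⁅y⁆⇒x≡y i , inj₂ ]′ (x∈p∪q⁻ ⁅ i ⁆ _ j∈)
  insert {f = f} i {B ∷ P} S@(cons (b , b∈B) const inc rest) with compare (f i) (f b)
  ... | tri< fi<fb _ _ = ⁅ i ⁆ ∷ B ∷ P ,
    cons (i , x∈⁅x⁆ i) (λ j∈ k∈ → cong f (trans (x∈⁅y⁆⇒x≡y i j∈) (sym (x∈⁅y⁆⇒x≡y i k∈))))
      (λ j∈ k∈ → subst (λ x → f x < _) (sym (x∈⁅y⁆⇒x≡y i j∈)) (below (x∈p∪q⁻ B (⋃ P) k∈))) S ,
    x∈p∪q⁺ (inj₁ (x∈⁅x⁆ i)) , (λ j∈ → x∈p∪q⁺ (inj₂ j∈)) ,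
    λ j∈ → [ inj₁ ∘ x∈⁅y⁆⇒x≡y i , inj₂ ]′ (x∈p∪q⁻ ⁅ i ⁆ _ j∈)
    where
    below : ∀ {k} → k ∈ B ⊎ k ∈ ⋃ P → f i < f k
    below (inj₁ k∈B) = subst (f i <_) (const b∈B k∈B) fi<fb
    below (inj₂ k∈P) = <-trans fi<fb (inc b∈B k∈P)
  ... | tri≈ _ fi≡fb _ = (⁅ i ⁆ ∪ B) ∷ P ,
    cons (i , x∈p∪q⁺ (inj₁ (x∈⁅x⁆ i))) (λ j∈ k∈ → trans (value j∈) (sym (value k∈)))
      (λ j∈ k∈ → subst (λ x → x < f _) (sym (value j∈)) (inc b∈B k∈)) rest ,
    x∈p∪q⁺ (inj₁ (x∈p∪q⁺ (inj₁ (x∈⁅x⁆ i)))) ,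
    (λ j∈ → x∈p∪q⁺ ([ (λ j∈B → inj₁ (x∈p∪q⁺ (inj₂ j∈B))) , inj₂ ]′ (x∈p∪q⁻ B (⋃ P) j∈))) ,
    λ j∈ → [ (λ j∈iB → [ inj₁ ∘ x∈⁅y⁆⇒x≡y i , (λ j∈B → inj₂ (x∈p∪q⁺ (inj₁ j∈B))) ]′
                        (x∈p∪q⁻ ⁅ i ⁆ B j∈iB))
           , (λ j∈P → inj₂ (x∈p∪q⁺ (inj₂ j∈P))) ]′ (x∈p∪q⁻ (⁅ i ⁆ ∪ B) (⋃ P) j∈)
    where
    value : ∀ {j} → j ∈ ⁅ i ⁆ ∪ B → f j ≡ f b
    value j∈ = [ (λ j∈i → trans (cong f (x∈⁅y⁆⇒x≡y i j∈i)) fi≡fb) , (λ j∈B → const j∈B b∈B) ]′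
      (x∈p∪q⁻ ⁅ i ⁆ B j∈)
  ... | tri> _ _ fb<fi with insert i rest
  ...   | P′ , S′ , i∈P′ , P⊆P′ , P′⊆iP = B ∷ P′ ,
    cons (b , b∈B) const (λ j∈B k∈P′ → above j∈B (P′⊆iP k∈P′)) S′ ,
    x∈p∪q⁺ (inj₂ i∈P′) ,
    (λ j∈ → x∈p∪q⁺ ([ inj₁ , inj₂ ∘ P⊆P′ ]′ (x∈p∪q⁻ B (⋃ P) j∈))) ,
    λ j∈ → [ (λ j∈B → inj₂ (x∈p∪q⁺ (inj₁ j∈B)))
           , (λ j∈P′ → [ inj₁ , (λ j∈P → inj₂ (x∈p∪q⁺ (inj₂ j∈P))) ]′ (P′⊆iP j∈P′)) ]′
             (x∈p∪q⁻ B (⋃ P′) j∈)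
    where
    above : ∀ {j k} → j ∈ B → k ≡ i ⊎ k ∈ ⋃ P → f j < f k
    above j∈B (inj₁ refl) = subst (_< f i) (const b∈B j∈B) fb<fi
    above j∈B (inj₂ k∈P) = inc j∈B k∈P

  sort : ∀ {n} (f : Fin n → Carrier) (is : List (Fin n)) →
         Σ[ P ∈ OrdPart n ] (Sorted f P × (∀ {i} → i ∈ˡ is → i ∈ ⋃ P))
  sort f [] = [] , [] , λ ()
  sort f (i ∷ is) with sort f is
  ... | P , S , is⊆P with insert i S
  ...   | P′ , S′ , i∈P′ , P⊆P′ , _ =
    P′ , S′ , λ { (here refl) → i∈P′ ; (there j∈) → P⊆P′ (is⊆P j∈) }

  -- Recursion on the finer partition: its first block is split off the first
  -- block of the coarser one.
  refines : ∀ {n} {f g : Fin n → Carrier} {P Q} → (∀ {i j} → f i < f j → g i < g j) →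
            Sorted g Q → Sorted f P → ⋃ P ⊆ˢ ⋃ Q → ⋃ Q ⊆ˢ ⋃ P → Refines Q P
  refines f⇒g [] [] P⊆Q Q⊆P = []
  refines f⇒g [] (cons (b , b∈B) _ _ _) P⊆Q Q⊆P = ⊥-elim (∉⊥ (P⊆Q (x∈p∪q⁺ (inj₁ b∈B))))
  refines f⇒g (cons (c , c∈C) _ _ _) [] P⊆Q Q⊆P = ⊥-elim (∉⊥ (Q⊆P (x∈p∪q⁺ (inj₁ c∈C))))
  refines {f = f} {g} {B ∷ P} {C ∷ Q} f⇒g (cons (c , c∈C) constC incC SQ)
    (cons (b , b∈B) constB incB SP) P⊆Q Q⊆P = result (nonempty? (B ─ C))
    where
    C⊆B : C ⊆ˢ B
    C⊆B {k} k∈C with x∈p∪q⁻ B (⋃ P) (Q⊆P (x∈p∪q⁺ (inj₁ k∈C)))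
    ... | inj₁ k∈B = k∈B
    -- If `k` lay in a later block of `P`, then f b < f k and hence g b < g k, although `k` is in
    -- the first block `C` of `Q`, where `g` is minimal.
    ... | inj₂ k∈P with x∈p∪q⁻ C (⋃ Q) (P⊆Q (x∈p∪q⁺ (inj₁ b∈B)))
    ...   | inj₁ b∈C = ⊥-elim (<-irrefl (constC b∈C k∈C) (f⇒g (incB b∈B k∈P)))
    ...   | inj₂ b∈Q = ⊥-elim (<-asym (incC k∈C b∈Q) (f⇒g (incB b∈B k∈P)))
    C∩Q≡∅ : ∀ {i} → i ∈ C → i ∉ ⋃ Q
    C∩Q≡∅ i∈C i∈Q = <-irrefl refl (incC i∈C i∈Q)
    tail⊆ : ∀ {i} → i ∈ ⋃ Q → i ∈ B ─ C ⊎ i ∈ ⋃ P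
    tail⊆ {i} i∈Q with x∈p∪q⁻ B (⋃ P) (Q⊆P (x∈p∪q⁺ (inj₂ i∈Q)))
    ... | inj₁ i∈B = inj₁ (x∈p∧x∉q⇒x∈p─q i∈B λ i∈C → C∩Q≡∅ i∈C i∈Q)
    ... | inj₂ i∈P = inj₂ i∈P
    rest⊆ : ∀ {i} → i ∈ ⋃ (B ∷ P) → i ∉ C → i ∈ ⋃ Q
    rest⊆ i∈ i∉C = [ ⊥-elim ∘ i∉C , (λ i∈Q → i∈Q) ]′ (x∈p∪q⁻ C (⋃ Q) (P⊆Q i∈))
    P⊆tail : ⋃ P ⊆ˢ ⋃ Q
    P⊆tail i∈P = rest⊆ (x∈p∪q⁺ (inj₂ i∈P)) λ i∈C → <-irrefl refl (incB (C⊆B i∈C) i∈P)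
    result : Dec (Nonempty (B ─ C)) → Refines (C ∷ Q) (B ∷ P)
    -- The blocks coincide. A segment of length one has union `C ∪ ⊥`, which accounts for the
    -- rewriting.
    result (no empty) = subst (λ D → Refines (C ∷ Q) (D ∷ P)) (trans (∪-identityʳ C) C≡B)
      (seg C [] (refines f⇒g SQ SP P⊆tail
        λ i∈Q → [ (λ i∈B─C → ⊥-elim (empty (_ , i∈B─C))) , (λ i∈P → i∈P) ]′ (tail⊆ i∈Q)))
      where
      C≡B : C ≡ B
      C≡B = ⊆-antisym C⊆B B⊆C
        where
        B⊆C : B ⊆ˢ C
        B⊆C {x} x∈B with x ∈? C
        ... | yes x∈C = x∈C
        ... | no x∉C = ⊥-elim (empty (x , x∈p∧x∉q⇒x∈p─q x∈B x∉C))
    -- The rest of `Q` refines `P` with `B ─ C` as its first block; `C` is then put in front of the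
    -- segment that makes up `B ─ C`.
    result (yes nonempty) = prepend (refines f⇒g SQ
        (cons nonempty (λ i∈ j∈ → constB (p─q⊆p B C i∈) (p─q⊆p B C j∈))
          (λ i∈ → incB (p─q⊆p B C i∈)) SP)
        ([ (λ i∈ → rest⊆ (x∈p∪q⁺ (inj₁ (p─q⊆p B C i∈))) (x∈p─q⇒x∉q B C i∈)) , P⊆tail ]′
          ∘ x∈p∪q⁻ (B ─ C) (⋃ P))
        (x∈p∪q⁺ ∘ tail⊆))
        refl
      where
      -- The first block is a variable `D` with an equation, since matching on `seg` must unify it
      -- with a union.
      prepend : ∀ {D} → Refines Q (D ∷ P) → D ≡ B ─ C → Refines (C ∷ Q) (B ∷ P)
      prepend (seg D Ds R) eq = subst (λ E → Refines _ (E ∷ P))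
        (trans (cong (C ∪_) eq) (p∪[q─p]≡q C⊆B)) (seg C (D ∷ Ds) R)

  -- A block of `P` composed of two or more blocks of `Q` would contain `b` and `c` with f b = f c
  -- but g b < g c. So each segment is a single block.
  refines-const⇒≡ : ∀ {n} {f g : Fin n → Carrier} {P Q} → (∀ {i j} → f i ≡ f j → g i ≡ g j) →
                   Refines Q P → Sorted f P → Sorted g Q → Q ≡ P
  refines-const⇒≡ f⇒g [] _ _ = refl
  refines-const⇒≡ f⇒g (seg B [] R) (cons _ _ _ SP) (cons _ _ _ SQ) =
    cong₂ _∷_ (sym (∪-identityʳ B)) (refines-const⇒≡ f⇒g R SP SQ)
  refines-const⇒≡ f⇒g (seg B (C ∷ Bs) R) (cons _ const _ _)
    (cons (b , b∈B) _ inc (cons (c , c∈C) _ _ _)) =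
    ⊥-elim (<-irrefl
      (f⇒g (const (x∈p∪q⁺ (inj₁ b∈B)) (x∈p∪q⁺ (inj₂ (x∈p∪q⁺ (inj₁ c∈C))))))
      (inc b∈B (x∈p∪q⁺ (inj₁ c∈C))))

  -- The conditions of `IsSweep` except covering, which tails do not inherit; this allows recursion
  -- on the list.
  IsSorted : ∀ {n} → (Fin n → Carrier) → OrdPart n → Set (c ⊔ ℓ)
  IsSorted {n} f P =
    (∀ (r : Fin (length P)) → Nonempty (lookup P r)) ×
    (∀ (r : Fin (length P)) (i j : Fin n) → i ∈ lookup P r → j ∈ lookup P r → f i ≡ f j) ×
    (∀ (r s : Fin (length P)) (i j : Fin n) → r <ᶠ s → i ∈ lookup P r → j ∈ lookup P s → f i < f j)

  IsSorted⇒Sorted : ∀ {n} {f : Fin n → Carrier} P → IsSorted f P → Sorted f P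
  IsSorted⇒Sorted [] _ = []
  IsSorted⇒Sorted (B ∷ P) (nonempty , const , inc) = cons (nonempty zero) (const zero _ _)
    (λ i∈B j∈P → let s , j∈s = ∈-⋃⇒∈-lookup P j∈P in inc zero (suc s) _ _ z<s i∈B j∈s)
    (IsSorted⇒Sorted P ((λ r → nonempty (suc r)) , (λ r → const (suc r)) ,
      λ r s i j r<s → inc (suc r) (suc s) i j (s<s r<s)))

  Sorted⇒IsSorted : ∀ {n} {f : Fin n → Carrier} {P} → Sorted f P → IsSorted f P
  Sorted⇒IsSorted [] = (λ ()) , (λ ()) , λ ()
  Sorted⇒IsSorted {n} {f} (cons {B} {P} nonempty const inc S) with Sorted⇒IsSorted S
  ... | nonempty′ , const′ , inc′ =
    (λ { zero → nonempty ; (suc r) → nonempty′ r }) ,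
    (λ { zero i j → const ; (suc r) → const′ r }) ,
    λ { zero (suc s) i j _ i∈B j∈s → inc i∈B (∈-lookup⇒∈-⋃ P s j∈s)
      ; (suc r) (suc s) i j (s≤s r<s) → inc′ r s i j r<s }

  IsSweep⇒Sorted : ∀ {n d} {A : Config n d} {u P} → IsSweep A u P →
                   Sorted (λ i → ⟨ u , A i ⟩) P × (∀ i → i ∈ ⋃ P)
  IsSweep⇒Sorted {P = P} (nonempty , cover , const , inc) =
    IsSorted⇒Sorted P (nonempty ,
      (λ r i j i∈ j∈ → lower (const r i j i∈ j∈)) ,
      (λ r s i j r<s i∈ j∈ → lower (inc r s i j r<s i∈ j∈))) ,
    λ i → let r , i∈r = cover i in ∈-lookup⇒∈-⋃ P r i∈r

  Sorted⇒IsSweep : ∀ {n d} {A : Config n d} {u P} →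
                   Sorted (λ i → ⟨ u , A i ⟩) P → (∀ i → i ∈ ⋃ P) → IsSweep A u P
  Sorted⇒IsSweep {P = P} S cover with Sorted⇒IsSorted S
  ... | nonempty , const , inc = nonempty , (λ i → ∈-⋃⇒∈-lookup P (cover i)) ,
    (λ r i j i∈ j∈ → lift (const r i j i∈ j∈)) ,
    λ r s i j r<s i∈ j∈ → lift (inc r s i j r<s i∈ j∈)

  sweep : ∀ {n d} (A : Config n d) u → Σ[ P ∈ OrdPart n ] IsSweep A u P
  sweep {n} A u with sort (λ i → ⟨ u , A i ⟩) (allFin n)
  ... | P , S , cover = P , Sorted⇒IsSweep {A = A} S λ i → cover (∈-allFin i)

-- Sweeps, sweep permutations and oriented matroids compared through orders of values.

module Determination {c ℓ} (K : OrderedField c ℓ) where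
  open OrderedField K
  open OF K
  open FieldProperties K
  open Covectors K
  open OrderedPartitions K

  gap : ∀ {n} → (Fin n → Carrier) → Fin n → Fin n → Sign
  gap f i j = sign (f j + - f i)

  SameOrder : ∀ {n} → (f g : Fin n → Carrier) → Set
  SameOrder f g = ∀ i j → gap f i j ≡ gap g i j

  gap-opposite : ∀ {n} (f : Fin n → Carrier) i j → gap f j i ≡ opposite (gap f i j)
  gap-opposite f i j = trans
    (cong sign (solve 2 (λ x y → x :+ :- y := :- (y :+ :- x)) refl (f i) (f j))) (sign-- _)

  gap-equal : ∀ {n} (f : Fin n → Carrier) {i j} → f i ≡ f j → gap f i j ≡ zer
  gap-equal f {i} {j} fi≡fj = sign-zero (trans (cong (λ x → f j + - x) fi≡fj) (-‿inverseʳ (f j)))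

  gap-less : ∀ {n} (f : Fin n → Carrier) {i j} → f i < f j → gap f i j ≡ pos
  gap-less f fi<fj = sign-pos (<⇒0<- fi<fj)

  equal-gap : ∀ {n} (f : Fin n → Carrier) {i j} → gap f i j ≡ zer → f i ≡ f j
  equal-gap f {i} {j} eq = trans (sym (+-identityˡ (f i)))
    (trans (cong (_+ f i) (sym (zero-sign eq)))
      (solve 2 (λ x y → (y :+ :- x) :+ x := y) refl (f i) (f j)))

  less-gap : ∀ {n} (f : Fin n → Carrier) {i j} → gap f i j ≡ pos → f i < f j
  less-gap f eq = 0<-⇒< (pos-sign eq)

  sameOrder-≡ : ∀ {n} {f g : Fin n → Carrier} → SameOrder f g → ∀ {i j} → f i ≡ f j → g i ≡ g j
  sameOrder-≡ {f = f} {g} f∼g fi≡fj = equal-gap g (trans (sym (f∼g _ _)) (gap-equal f fi≡fj))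

  sameOrder-< : ∀ {n} {f g : Fin n → Carrier} → SameOrder f g → ∀ {i j} → f i < f j → g i < g j
  sameOrder-< {f = f} {g} f∼g fi<fj = less-gap g (trans (sym (f∼g _ _)) (gap-less f fi<fj))

  -- Diagonal gaps vanish and reversing a pair negates its gap, so the ground set of `SweepOM`
  -- carries the whole order.
  gaps⇒sameOrder : ∀ {n} {f g : Fin n → Carrier} →
                   (∀ {i j} → i <ᶠ j → gap f i j ≡ gap g i j) → SameOrder f g
  gaps⇒sameOrder {f = f} {g} same i j with Fin.<-cmp i j
  ... | tri< i<j _ _ = same i<j
  ... | tri≈ _ refl _ = trans (gap-equal f refl) (sym (gap-equal g refl))
  ... | tri> _ _ j<i = trans (gap-opposite f j i)
          (trans (cong opposite (same j<i)) (sym (gap-opposite g j i)))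

  gap-shifted : ∀ {n} (f : Fin n → Carrier) t i j → (t + f j) + - (t + f i) ≡ f j + - f i
  gap-shifted f t i j =
    solve 3 (λ t x y → (t :+ y) :+ :- (t :+ x) := y :+ :- x) refl t (f i) (f j)

  shift-to-zero : ∀ {n} {f g : Fin n → Carrier} → SameOrder f g → ∀ {t i} → t + f i ≡ 0# →
                  ∀ j → sign (t + f j) ≡ sign (- g i + g j)
  shift-to-zero {f = f} {g} f∼g {t} {i} t+fi≡0 j = trans (cong sign shifted)
    (trans (f∼g i j) (cong sign (solve 2 (λ x y → y :+ :- x := :- x :+ y) refl (g i) (g j))))
    where
    shifted : t + f j ≡ f j + - f i
    shifted = trans (trans (solve 1 (λ x → x := x :+ :- con (+ 0)) refl (t + f j))
      (cong (λ z → (t + f j) + - z) (sym t+fi≡0))) (gap-shifted f t i j)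

  -- If `- t` is a value f i, the matching level is g i. Otherwise `- t` cuts the points into a
  -- lower and an upper class, which `g` keeps in order, and `separate` finds a level between them.
  sameOrder-shift : ∀ {n} {f g : Fin n → Carrier} → SameOrder f g → ∀ t →
                    ∃[ t′ ] (∀ i → sign (t + f i) ≡ sign (t′ + g i))
  sameOrder-shift {n} {f} {g} f∼g t = by-zero (any? λ i → sign (t + f i) ≟ˢ zer)
    where
    Result = ∃[ t′ ] (∀ i → sign (t + f i) ≡ sign (t′ + g i))
    less : ∀ {i j} → sign (t + f i) ≡ neg → sign (t + f j) ≡ pos → g i < g j
    less {i} {j} t+fi<0 0<t+fj = sameOrder-< f∼g (0<-⇒< (subst (0# <_) (gap-shifted f t i j)
      (+-pos (pos-sign 0<t+fj) (x<0⇒0<-x (neg-sign t+fi<0)))))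
    by-zero : Dec (∃[ i ] sign (t + f i) ≡ zer) → Result
    by-zero (yes (i , t+fi≡0)) = - g i , shift-to-zero f∼g (zero-sign t+fi≡0)
    by-zero (no t+f≢0) =
      let τ , below , above =
            separate g (λ i → sign (t + f i) ≟ˢ neg) (λ i → sign (t + f i) ≟ˢ pos) less
      in - τ , λ i → by-sign τ i (below i) (above i) (sign (t + f i)) refl
      where
      by-sign : ∀ τ i → (sign (t + f i) ≡ neg → g i < τ) → (sign (t + f i) ≡ pos → τ < g i) →
                ∀ s → sign (t + f i) ≡ s → sign (t + f i) ≡ sign (- τ + g i)
      by-sign τ i below above neg eq = trans eq (sym (sign-neg (subst (_< 0#)
        (solve 2 (λ x y → :- (y :+ :- x) := :- y :+ x) refl (g i) τ) (0<x⇒-x<0 (<⇒0<- (below eq))))))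
      by-sign τ i below above zer eq = ⊥-elim (t+f≢0 (i , eq))
      by-sign τ i below above pos eq = trans eq (sym (sign-pos (subst (0# <_)
        (solve 2 (λ x y → x :+ :- y := :- y :+ x) refl (g i) τ) (<⇒0<- (above eq)))))

  values : ∀ {n d} → Config n d → Vec d → Fin n → Carrier
  values A u i = ⟨ u , A i ⟩

  infix 4 _≼_
  -- The pivot of the equivalences: inclusion of `Sweeps` and inclusion of `SweepOM` are each
  -- equivalent to it.
  _≼_ : ∀ {n d} → Config n d → Config n d → Set c
  A ≼ A′ = ∀ u → ∃[ u′ ] SameOrder (values A u) (values A′ u′)

  module _ {n d : ℕ} where

    -- Both orders are read off from the positions of the blocks in the common partition `P`.
    sweep-sameOrder : ∀ (A A′ : Config n d) P {u u′} → IsSweep A u P → IsSweep A′ u′ P →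
                      SameOrder (values A u) (values A′ u′)
    sweep-sameOrder A A′ P {u} {u′} (_ , cover , const , inc) (_ , _ , const′ , inc′) i j
      with cover i | cover j
    ... | r , i∈r | s , j∈s with Fin.<-cmp r s
    ...   | tri< r<s _ _ = trans (gap-less (values A u) (lower (inc r s i j r<s i∈r j∈s)))
              (sym (gap-less (values A′ u′) (lower (inc′ r s i j r<s i∈r j∈s))))
    ...   | tri≈ _ refl _ = trans (gap-equal (values A u) (lower (const r i j i∈r j∈s)))
              (sym (gap-equal (values A′ u′) (lower (const′ r i j i∈r j∈s))))
    ...   | tri> _ _ s<r = trans (gap-opposite (values A u) j i)
              (trans (cong opposite (trans (gap-less (values A u) (lower (inc s r j i s<r j∈s i∈r)))
                (sym (gap-less (values A′ u′) (lower (inc′ s r j i s<r j∈s i∈r))))))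
              (sym (gap-opposite (values A′ u′) j i)))

    sweep-transfer : ∀ (A A′ : Config n d) P {u u′} → SameOrder (values A u) (values A′ u′) →
                     IsSweep A u P → IsSweep A′ u′ P
    sweep-transfer A A′ P {u} {u′} same (nonempty , cover , const , inc) = nonempty , cover ,
      (λ r i j i∈ j∈ → lift (sameOrder-≡ {f = values A u} {values A′ u′} same
        (lower (const r i j i∈ j∈)))) ,
      λ r s i j r<s i∈ j∈ → lift (sameOrder-< {f = values A u} {values A′ u′} same
        (lower (inc r s i j r<s i∈ j∈)))

    Sweeps⊆⇒≼ : ∀ {A A′ : Config n d} → Sweeps A ⊆ Sweeps A′ → A ≼ A′
    Sweeps⊆⇒≼ {A} {A′} A⊆A′ u with sweep A u
    ... | P , isSweep with A⊆A′ {P} (u , isSweep)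
    ...   | u′ , isSweep′ = u′ , sweep-sameOrder A A′ P isSweep isSweep′

    ≼⇒Sweeps⊆ : ∀ {A A′ : Config n d} → A ≼ A′ → Sweeps A ⊆ Sweeps A′
    ≼⇒Sweeps⊆ {A} {A′} A≼A′ {P} (u , isSweep) with A≼A′ u
    ... | u′ , same = u′ , sweep-transfer A A′ P same isSweep

    sign-difference : ∀ (A : Config n d) u i j → sign ⟨ u , A j -ᵛ A i ⟩ ≡ gap (values A u) i j
    sign-difference A u i j = cong sign (⟨,-⟩ u (A j) (A i))

    SweepOM⊆⇒≼ : ∀ {A A′ : Config n d} → SweepOM A ⊆ SweepOM A′ → A ≼ A′
    SweepOM⊆⇒≼ {A} {A′} A⊆A′ u
      with A⊆A′ {λ p → sign ⟨ u , A (proj₂ (proj₁ p)) -ᵛ A (proj₁ (proj₁ p)) ⟩} (u , λ p → hasSign _)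
    ... | u′ , h′ = u′ , gaps⇒sameOrder λ {i} {j} i<j →
      trans (sym (sign-difference A u i j))
        (trans (sym (sign-unique _ (h′ ((i , j) , i<j)))) (sign-difference A′ u′ i j))

    ≼⇒SweepOM⊆ : ∀ {A A′ : Config n d} → A ≼ A′ → SweepOM A ⊆ SweepOM A′
    ≼⇒SweepOM⊆ {A} {A′} A≼A′ (u , h) with A≼A′ u
    ... | u′ , same = u′ , λ { p@((i , j) , _) → hasSign-resp
      (trans (sign-difference A u i j) (trans (same i j) (sym (sign-difference A′ u′ i j)))) (h p) }

    ⟨,ext0⟩ : ∀ (w : Vec (suc d)) v → ⟨ w , ext v 0# ⟩ ≡ ⟨ (λ k → w (suc k)) , v ⟩
    ⟨,ext0⟩ w v = trans (cong (_+ ⟨ (λ k → w (suc k)) , v ⟩) (zeroʳ (w zero))) (+-identityˡ _)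

    ⟨,ext1⟩ : ∀ (w : Vec (suc d)) v → ⟨ w , ext v 1# ⟩ ≡ w zero + ⟨ (λ k → w (suc k)) , v ⟩
    ⟨,ext1⟩ w v = cong (_+ ⟨ (λ k → w (suc k)) , v ⟩) (*-identityʳ (w zero))

    -- The entries at pairs see only the linear part of `w`, which `≼` transfers. The entries at
    -- points also see the constant part, which `sameOrder-shift` adjusts.
    ≼⇒BigOM⊆ : ∀ {A A′ : Config n d} → A ≼ A′ → BigOM A ⊆ BigOM A′
    ≼⇒BigOM⊆ {A} {A′} A≼A′ (w , h) with A≼A′ (λ k → w (suc k))
    ... | u′ , same with sameOrder-shift same (w zero)
    ...   | t′ , same-shifted = ext u′ t′ , λ
      { (inj₁ i) → hasSign-resp (trans (cong sign (⟨,ext1⟩ w (A i)))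
          (trans (same-shifted i) (sym (cong sign (⟨,ext1⟩ (ext u′ t′) (A′ i)))))) (h (inj₁ i))
      ; (inj₂ p@((i , j) , _)) → hasSign-resp
          (trans (cong sign (⟨,ext0⟩ w _)) (trans (sign-difference A _ i j)
            (trans (same i j) (trans (sym (sign-difference A′ u′ i j))
              (sym (cong sign (⟨,ext0⟩ (ext u′ t′) _))))))) (h (inj₂ p)) }

    -- `SweepOM` is the restriction of `BigOM` to pairs: extend `u` by constant part zero, transfer,
    -- and forget the point entries.
    BigOM⊆⇒SweepOM⊆ : ∀ {A A′ : Config n d} → BigOM A ⊆ BigOM A′ → SweepOM A ⊆ SweepOM A′
    BigOM⊆⇒SweepOM⊆ {A} {A′} A⊆A′ {X} (u , h)
      with A⊆A′ {[ (λ i → sign ⟨ ext u 0# , ext (A i) 1# ⟩) , X ]′}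
             (ext u 0# , λ { (inj₁ i) → hasSign _
                           ; (inj₂ p) → hasSign-resp (sym (cong sign (⟨,ext0⟩ (ext u 0#) _))) (h p) })
    ... | w , h′ = (λ k → w (suc k)) , λ p → hasSign-resp (cong sign (⟨,ext0⟩ w _)) (h′ (inj₂ p))

    BigOM⊆⇒LittleOM⊆ : ∀ {A A′ : Config n d} → BigOM A ⊆ BigOM A′ → LittleOM A ⊆ LittleOM A′
    BigOM⊆⇒LittleOM⊆ {A} {A′} A⊆A′ {X} (w , h)
      with A⊆A′ {[ X , (λ p → sign ⟨ w , bigVec A (inj₂ p) ⟩) ]′}
             (w , λ { (inj₁ i) → h i ; (inj₂ p) → hasSign _ })
    ... | w′ , h′ = w′ , λ i → h′ (inj₁ i)

    -- The vectors of the sweep oriented matroid, enumerated over all ordered pairs because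
    -- `Composition` works over `Fin N`. Diagonal pairs give loops and reversed pairs give
    -- negatives.
    differences : Config n d → Fin (n ℕ.* n) → Vec d
    differences A e = A (proj₂ (remQuot {n} n e)) -ᵛ A (proj₁ (remQuot {n} n e))

    σ-differences : ∀ (A : Config n d) u e →
      σ (differences A) u e ≡ gap (values A u) (proj₁ (remQuot {n} n e)) (proj₂ (remQuot {n} n e))
    σ-differences A u e = sign-difference A u _ _

    gap-differences : ∀ (A : Config n d) u i j →
      gap (values A u) i j ≡ σ (differences A) u (combine i j)
    gap-differences A u i j = sym (trans (σ-differences A u (combine i j))
      (cong (λ p → gap (values A u) (proj₁ p) (proj₂ p)) (remQuot-combine {n} i j)))

    -- Suppose `u` vanishes on a nonzero difference. Perturbing `u` along that difference gives a
    -- sweep `Q` refining `P`, equal to `P` by maximality, so the perturbed functional vanishes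
    -- there too. But its sign there is that of the difference paired with itself.
    sweepPerm⇒generic : ∀ (A : Config n d) P {u} → IsSweep A u P →
      (∀ Q → Sweeps A Q → Refines Q P → Q ≡ P) → Generic (differences A) u
    sweepPerm⇒generic A P {u} isSweep maximal e ue≡0 =
      decidable-stable (all? λ k → differences A e k ≟ 0#)
        λ e-not-loop → e-not-loop (contra e-not-loop)
      where
      contra : ¬ (∀ k → differences A e k ≡ 0#) → ∀ k → differences A e k ≡ 0#
      contra e-not-loop with perturb (differences A) u (differences A e)
      ... | w , w≡ with sweep A w
      ...   | Q , isSweep-w = ⟨v,v⟩-sign (differences A e)
              (∙-zeroʳ (σ (differences A) u e) (trans (sym (w≡ e)) we≡0))
        where
        finer : ∀ {i j} → values A u i < values A u j → values A w i < values A w j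
        finer {i} {j} ui<uj = less-gap (values A w) (trans (gap-differences A w i j)
          (trans (w≡ (combine i j)) (cong (_∙ _)
            (trans (sym (gap-differences A u i j)) (gap-less (values A u) ui<uj)))))
        SQ = IsSweep⇒Sorted {A = A} {P = Q} isSweep-w
        SP = IsSweep⇒Sorted {A = A} {P = P} isSweep
        Q≡P : Q ≡ P
        Q≡P = maximal Q (w , isSweep-w) (refines finer (proj₁ SQ) (proj₁ SP)
          (λ {i} _ → proj₂ SQ i) (λ {i} _ → proj₂ SP i))
        we≡0 : σ (differences A) w e ≡ zer
        we≡0 = trans (σ-differences A w e) (trans
          (sweep-sameOrder A A P (subst (IsSweep A w) Q≡P isSweep-w) isSweep _ _)
          (trans (sym (σ-differences A u e)) ue≡0))

    -- A generic `u` takes equal values only at coinciding points, and no other functional can tell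
    -- those apart, so no block can be split.
    generic⇒sweepPerm : ∀ (A : Config n d) P {u} → IsSweep A u P → Generic (differences A) u →
                        SweepPerms A P
    generic⇒sweepPerm A P {u} isSweep generic = (u , isSweep) , λ Q (w , isSweep-w) Q⊑P →
      refines-const⇒≡ (coincide w) Q⊑P
        (proj₁ (IsSweep⇒Sorted {A = A} {P = P} isSweep))
        (proj₁ (IsSweep⇒Sorted {A = A} {P = Q} isSweep-w))
      where
      coincide : ∀ w {i j} → values A u i ≡ values A u j → values A w i ≡ values A w j
      coincide w {i} {j} ui≡uj = equal-gap (values A w) (trans (gap-differences A w i j)
        (sign-zero (⟨,0⟩ w _ (generic (combine i j)
          (trans (sym (gap-differences A u i j)) (gap-equal (values A u) ui≡uj))))))

    SweepPerms⊆⇒topes : ∀ {A A′ : Config n d} → SweepPerms A ⊆ SweepPerms A′ →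
      ∀ u → Generic (differences A) u →
      ∃[ u′ ] (Generic (differences A′) u′ × (∀ e → σ (differences A) u e ≡ σ (differences A′) u′ e))
    SweepPerms⊆⇒topes {A} {A′} A⊆A′ u generic =
      let P , isSweep = sweep A u
          (u′ , isSweep′) , maximal′ = A⊆A′ {P} (generic⇒sweepPerm A P isSweep generic)
      in u′ , sweepPerm⇒generic A′ P isSweep′ maximal′ , λ e →
        trans (σ-differences A u e) (trans (sweep-sameOrder A A′ P isSweep isSweep′ _ _)
          (sym (σ-differences A′ u′ e)))

    -- Both inclusions serve even this one direction: a tope of `A′` is pulled back to `A`, composed
    -- there, and sent to `A′` again.
    SweepPerms≐⇒≼ : ∀ {A A′ : Config n d} → SweepPerms A ≐ SweepPerms A′ → A ≼ A′
    SweepPerms≐⇒≼ {A} {A′} (A⊆A′ , A′⊆A) u =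
      let u′ , u≡u′ = topes-determine-covectors (differences A) (differences A′)
             (SweepPerms⊆⇒topes {A} {A′} A⊆A′) (SweepPerms⊆⇒topes {A′} {A} A′⊆A) u
      in u′ , λ i j → trans (gap-differences A u i j)
        (trans (u≡u′ (combine i j)) (sym (gap-differences A′ u′ i j)))

    -- The reverse inclusion preserves maximality: a sweep of `A′` refining `P` is also a sweep of
    -- `A`.
    Sweeps≐⇒SweepPerms⊆ : ∀ {A A′ : Config n d} → Sweeps A ≐ Sweeps A′ → SweepPerms A ⊆ SweepPerms A′
    Sweeps≐⇒SweepPerms⊆ (A⊆A′ , A′⊆A) {P} (isSweep , maximal) =
      A⊆A′ {P} isSweep , λ Q Q-isSweep → maximal Q (A′⊆A {Q} Q-isSweep)

    module _ {A A′ : Config n d} where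

      infix 4 _≃_
      _≃_ : Config n d → Config n d → Set c
      B ≃ B′ = B ≼ B′ × B′ ≼ B

      SweepPerms⇒≃ : SweepPerms A ≐ SweepPerms A′ → A ≃ A′
      SweepPerms⇒≃ eq@(A⊆A′ , A′⊆A) =
        SweepPerms≐⇒≼ {A} {A′} eq , SweepPerms≐⇒≼ {A′} {A} ((λ {P} → A′⊆A {P}) , λ {P} → A⊆A′ {P})

      Sweeps⇒≃ : Sweeps A ≐ Sweeps A′ → A ≃ A′
      Sweeps⇒≃ (A⊆A′ , A′⊆A) =
        Sweeps⊆⇒≼ {A} {A′} (λ {P} → A⊆A′ {P}) , Sweeps⊆⇒≼ {A′} {A} λ {P} → A′⊆A {P}

      SweepOM⇒≃ : SweepOM A ≐ SweepOM A′ → A ≃ A′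
      SweepOM⇒≃ (A⊆A′ , A′⊆A) = SweepOM⊆⇒≼ {A} {A′} A⊆A′ , SweepOM⊆⇒≼ {A′} {A} A′⊆A

      ≃⇒Sweeps : A ≃ A′ → Sweeps A ≐ Sweeps A′
      ≃⇒Sweeps (A≼A′ , A′≼A) =
        (λ {P} → ≼⇒Sweeps⊆ {A} {A′} A≼A′ {P}) , λ {P} → ≼⇒Sweeps⊆ {A′} {A} A′≼A {P}

      ≃⇒SweepOM : A ≃ A′ → SweepOM A ≐ SweepOM A′
      ≃⇒SweepOM (A≼A′ , A′≼A) = ≼⇒SweepOM⊆ {A} {A′} A≼A′ , ≼⇒SweepOM⊆ {A′} {A} A′≼A

      ≃⇒BigOM : A ≃ A′ → BigOM A ≐ BigOM A′
      ≃⇒BigOM (A≼A′ , A′≼A) = ≼⇒BigOM⊆ {A} {A′} A≼A′ , ≼⇒BigOM⊆ {A′} {A} A′≼A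

      Sweeps⇒SweepPerms : Sweeps A ≐ Sweeps A′ → SweepPerms A ≐ SweepPerms A′
      Sweeps⇒SweepPerms eq@(A⊆A′ , A′⊆A) =
        (λ {P} → Sweeps≐⇒SweepPerms⊆ {A} {A′} eq {P}) ,
        λ {P} → Sweeps≐⇒SweepPerms⊆ {A′} {A} ((λ {Q} → A′⊆A {Q}) , λ {Q} → A⊆A′ {Q}) {P}

      BigOM⇒SweepOM : BigOM A ≐ BigOM A′ → SweepOM A ≐ SweepOM A′
      BigOM⇒SweepOM (A⊆A′ , A′⊆A) = BigOM⊆⇒SweepOM⊆ {A} {A′} A⊆A′ , BigOM⊆⇒SweepOM⊆ {A′} {A} A′⊆A

      BigOM⇒LittleOM : BigOM A ≐ BigOM A′ → LittleOM A ≐ LittleOM A′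
      BigOM⇒LittleOM (A⊆A′ , A′⊆A) = BigOM⊆⇒LittleOM⊆ {A} {A′} A⊆A′ , BigOM⊆⇒LittleOM⊆ {A′} {A} A′⊆A

-- A square and a trapezoid with equal little oriented matroids.

module Counterexample {c ℓ} (K : OrderedField c ℓ) where
  open OrderedField K
  open OF K
  open FieldProperties K
  open Covectors K
  open OrderedPartitions K
  open Determination K

  point : Carrier → Carrier → Vec 2
  point x y zero = x
  point x y (suc zero) = y

  -- The fourth points differ, so that two opposite sides of the square are
  -- parallel while their counterparts in the trapezoid are not.
  quadrilateral : Carrier → Config 4 2
  quadrilateral x zero = point 0# 1#
  quadrilateral x (suc zero) = point 0# 0#
  quadrilateral x (suc (suc zero)) = point 1# 0#
  quadrilateral x (suc (suc (suc zero))) = point x 1#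

  square trapezoid : Config 4 2
  square = quadrilateral 1#
  trapezoid = quadrilateral 2#

  -- The first three points form an affine basis of the plane: the origin yields the constant term,
  -- its two neighbours the linear coefficients.
  fullDim : ∀ x → FullDim (quadrilateral x)
  fullDim x w vanish = λ { zero → w₀≡0 ; (suc zero) → w₁≡0 ; (suc (suc zero)) → w₂≡0 }
    where
    o = con (+ 0)
    i = con (+ 1)
    w₀ = w zero
    w₁ = w (suc zero)
    w₂ = w (suc (suc zero))
    w₀≡0 : w₀ ≡ 0#
    w₀≡0 = trans (solve 3 (λ t p q → t := t :* i :+ (p :* o :+ (q :* o :+ o))) refl w₀ w₁ w₂)
      (vanish (suc zero))
    difference-zero : ∀ {a b} → a ≡ 0# → b ≡ 0# → a + - b ≡ 0#
    difference-zero a≡0 b≡0 = trans (cong₂ (λ a b → a + - b) a≡0 b≡0) (-‿inverseʳ 0#)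
    w₁≡0 : w₁ ≡ 0#
    w₁≡0 = trans
      (solve 3 (λ t p q → p := t :* i :+ (p :* i :+ (q :* o :+ o)) :+ :- t) refl w₀ w₁ w₂)
      (difference-zero (vanish (suc (suc zero))) w₀≡0)
    w₂≡0 : w₂ ≡ 0#
    w₂≡0 = trans
      (solve 3 (λ t p q → q := t :* i :+ (p :* o :+ (q :* i :+ o)) :+ :- t) refl w₀ w₁ w₂)
      (difference-zero (vanish zero) w₀≡0)

  functional : Carrier → Carrier → Carrier → Vec 3
  functional t p q zero = t
  functional t p q (suc zero) = p
  functional t p q (suc (suc zero)) = q

  sign-double : ∀ {x y} → y ≡ 2# * x → sign x ≡ sign y
  sign-double {x} y≡2x = sym (trans (cong sign y≡2x) (sign-* x 0<2))

  -- The affine dependencies are a − b + c − d = 0 for the square and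
  -- 2a − 2b + c − d = 0 for the trapezoid, up to relabelling, so a positive rescaling of the
  -- lifted points carries one configuration to the other.
  square⊆trapezoid : LittleOM square ⊆ LittleOM trapezoid
  -- The values at the trapezoid points are 2, 1, 1, 2 times those of `w` at the square points.
  square⊆trapezoid (w , h) = functional t p (t + 2# * q) , λ
    { zero → hasSign-resp (sign-double (solve 3 (λ t p q →
        t :* i :+ (p :* o :+ ((t :+ two :* q) :* i :+ o))
          := two :* (t :* i :+ (p :* o :+ (q :* i :+ o)))) refl t p q)) (h zero)
    ; (suc zero) → hasSign-resp (cong sign (solve 3 (λ t p q →
        t :* i :+ (p :* o :+ (q :* o :+ o))
          := t :* i :+ (p :* o :+ ((t :+ two :* q) :* o :+ o))) refl t p q)) (h (suc zero))
    ; (suc (suc zero)) → hasSign-resp (cong sign (solve 3 (λ t p q →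
        t :* i :+ (p :* i :+ (q :* o :+ o))
          := t :* i :+ (p :* i :+ ((t :+ two :* q) :* o :+ o))) refl t p q)) (h (suc (suc zero)))
    ; (suc (suc (suc zero))) → hasSign-resp (sign-double (solve 3 (λ t p q →
        t :* i :+ (p :* two :+ ((t :+ two :* q) :* i :+ o))
          := two :* (t :* i :+ (p :* i :+ (q :* i :+ o)))) refl t p q)) (h (suc (suc (suc zero)))) }
    where
    o = con (+ 0)
    i = con (+ 1)
    two = con (+ 2)
    t = w zero
    p = w (suc zero)
    q = w (suc (suc zero))

  trapezoid⊆square : LittleOM trapezoid ⊆ LittleOM square
  -- Twice the inverse of the preceding substitution; the factors are now 1, 2, 2, 1.
  trapezoid⊆square (w , h) = functional (2# * t) (2# * p) (q + - t) , λ
    { zero → hasSign-resp (cong sign (solve 3 (λ t p q →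
        t :* i :+ (p :* o :+ (q :* i :+ o))
          := (two :* t) :* i :+ ((two :* p) :* o :+ ((q :+ :- t) :* i :+ o))) refl t p q)) (h zero)
    ; (suc zero) → hasSign-resp (sign-double (solve 3 (λ t p q →
        (two :* t) :* i :+ ((two :* p) :* o :+ ((q :+ :- t) :* o :+ o))
          := two :* (t :* i :+ (p :* o :+ (q :* o :+ o)))) refl t p q)) (h (suc zero))
    ; (suc (suc zero)) → hasSign-resp (sign-double (solve 3 (λ t p q →
        (two :* t) :* i :+ ((two :* p) :* i :+ ((q :+ :- t) :* o :+ o))
          := two :* (t :* i :+ (p :* i :+ (q :* o :+ o)))) refl t p q)) (h (suc (suc zero)))
    ; (suc (suc (suc zero))) → hasSign-resp (cong sign (solve 3 (λ t p q →
        t :* i :+ (p :* two :+ (q :* i :+ o))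
          := (two :* t) :* i :+ ((two :* p) :* i :+ ((q :+ :- t) :* i :+ o))) refl t p q))
        (h (suc (suc (suc zero)))) }
    where
    o = con (+ 0)
    i = con (+ 1)
    two = con (+ 2)
    t = w zero
    p = w (suc zero)
    q = w (suc (suc zero))

  -- Its values at the trapezoid points are -1, 0, 2, 3, so it sees them in index order, an order
  -- impossible on the square.
  direction : Vec 2
  direction = point 2# (- 1#)

  0<1<2<3 : ∀ {i j} → i <ᶠ j → values trapezoid direction i < values trapezoid direction j
  0<1<2<3 {i} {j} = increasing i j
    where
    f = values trapezoid direction
    o = con (+ 0)
    one = con (+ 1)
    two = con (+ 2)
    f₀<f₁ : f zero < f (suc zero)
    f₀<f₁ = 0<-⇒< (subst (0# <_) (solve 0 (one :=
      (two :* o :+ (:- one :* o :+ o)) :+ :- (two :* o :+ (:- one :* one :+ o))) refl) 0<1)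
    f₁<f₂ : f (suc zero) < f (suc (suc zero))
    f₁<f₂ = 0<-⇒< (subst (0# <_) (solve 0 (two :=
      (two :* one :+ (:- one :* o :+ o)) :+ :- (two :* o :+ (:- one :* o :+ o))) refl) 0<2)
    f₂<f₃ : f (suc (suc zero)) < f (suc (suc (suc zero)))
    f₂<f₃ = 0<-⇒< (subst (0# <_) (solve 0 (one :=
      (two :* two :+ (:- one :* one :+ o)) :+ :- (two :* one :+ (:- one :* o :+ o))) refl) 0<1)
    increasing : ∀ i j → i <ᶠ j → f i < f j
    increasing zero (suc zero) _ = f₀<f₁
    increasing zero (suc (suc zero)) _ = <-trans f₀<f₁ f₁<f₂
    increasing zero (suc (suc (suc zero))) _ = <-trans f₀<f₁ (<-trans f₁<f₂ f₂<f₃)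
    increasing (suc zero) (suc (suc zero)) _ = f₁<f₂
    increasing (suc zero) (suc (suc (suc zero))) _ = <-trans f₁<f₂ f₂<f₃
    increasing (suc (suc zero)) (suc (suc (suc zero))) _ = f₂<f₃
    increasing (suc zero) (suc zero) (s≤s ())
    increasing (suc (suc zero)) (suc zero) (s≤s ())
    increasing (suc (suc zero)) (suc (suc zero)) (s≤s (s≤s ()))
    increasing (suc (suc (suc zero))) (suc zero) (s≤s ())
    increasing (suc (suc (suc zero))) (suc (suc zero)) (s≤s (s≤s ()))
    increasing (suc (suc (suc zero))) (suc (suc (suc zero))) (s≤s (s≤s (s≤s ())))

  values-injective : ∀ {i j} → values trapezoid direction i ≡ values trapezoid direction j → i ≡ j
  values-injective {i} {j} fi≡fj with Fin.<-cmp i j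
  ... | tri< i<j _ _ = ⊥-elim (<-irrefl fi≡fj (0<1<2<3 {i} {j} i<j))
  ... | tri≈ _ i≡j _ = i≡j
  ... | tri> _ _ j<i = ⊥-elim (<-irrefl (sym fi≡fj) (0<1<2<3 {j} {i} j<i))

  -- The four values are distinct, so only differences of a point with itself are annihilated.
  direction-generic : Generic (differences trapezoid) direction
  direction-generic e fe≡0 k = trans
    (cong (λ i → trapezoid j k + - trapezoid i k)
      (values-injective {i} {j} (equal-gap (values trapezoid direction) {i} {j}
        (trans (sym (σ-differences trapezoid direction e)) fe≡0))))
    (-‿inverseʳ (trapezoid j k))
    where
    i = proj₁ (remQuot {4} 4 e)
    j = proj₂ (remQuot {4} 4 e)

  -- In the square, the side from point 0 to point 1 is opposite to the side from point 2 to point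
  -- 3, so the two gaps sum to zero and cannot both be positive.
  ¬sameOrder : ∀ u → ¬ SameOrder (values trapezoid direction) (values square u)
  ¬sameOrder u same = <-irrefl refl (subst (0# <_) sum≡0
      (+-pos (<⇒0<- (less {zero} {suc zero} (s≤s z≤n)))
             (<⇒0<- (less {suc (suc zero)} {suc (suc (suc zero))} (s≤s (s≤s (s≤s z≤n)))))))
    where
    less : ∀ {i j} → i <ᶠ j → values square u i < values square u j
    less {i} {j} i<j =
      sameOrder-< {f = values trapezoid direction} {values square u} same {i} {j} (0<1<2<3 {i} {j} i<j)
    o = con (+ 0)
    i = con (+ 1)
    sum≡0 = solve 2 (λ p q →
      ((p :* o :+ (q :* o :+ o)) :+ :- (p :* o :+ (q :* i :+ o))) :+
      ((p :* i :+ (q :* i :+ o)) :+ :- (p :* i :+ (q :* o :+ o))) := o) refl (u zero) (u (suc zero))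

  sweepPerms-differ : ¬ (SweepPerms square ≐ SweepPerms trapezoid)
  sweepPerms-differ (_ , trapezoid⊆) =
    let P , isSweep = sweep trapezoid direction
        (u , isSweep′) , _ =
          trapezoid⊆ {P} (generic⇒sweepPerm trapezoid P {direction} isSweep direction-generic)
    in ¬sameOrder u (sweep-sameOrder trapezoid square P {direction} {u} isSweep isSweep′)

theorem3p5 : ∀ {c ℓ : Level} (K : OrderedField c ℓ) →
    (∀ {n d : ℕ} (A A′ : OF.Config K n d) → OF.FullDim K A → OF.FullDim K A′ →
    ((OF.SweepPerms K A ≐ OF.SweepPerms K A′) ⇔ (OF.Sweeps K A ≐ OF.Sweeps K A′)) ×
    ((OF.Sweeps K A ≐ OF.Sweeps K A′) ⇔ (OF.SweepOM K A ≐ OF.SweepOM K A′)) ×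
    ((OF.SweepOM K A ≐ OF.SweepOM K A′) ⇔ (OF.BigOM K A ≐ OF.BigOM K A′)) ×
    ((OF.SweepPerms K A ≐ OF.SweepPerms K A′) → OF.LittleOM K A ≐ OF.LittleOM K A′) ×
    ((OF.Sweeps K A ≐ OF.Sweeps K A′) → OF.LittleOM K A ≐ OF.LittleOM K A′) ×
    ((OF.SweepOM K A ≐ OF.SweepOM K A′) → OF.LittleOM K A ≐ OF.LittleOM K A′) ×
    ((OF.BigOM K A ≐ OF.BigOM K A′) → OF.LittleOM K A ≐ OF.LittleOM K A′)) ×
    (∃[ n ] ∃[ d ] Σ[ A ∈ OF.Config K n d ] Σ[ A′ ∈ OF.Config K n d ]
    (OF.FullDim K A × OF.FullDim K A′ ×
    (OF.LittleOM K A ≐ OF.LittleOM K A′) × ¬ (OF.SweepPerms K A ≐ OF.SweepPerms K A′)))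
theorem3p5 K =
  (λ A A′ _ _ →
    mk⇔ (≃⇒Sweeps {A = A} {A′} ∘ SweepPerms⇒≃ {A = A} {A′}) (Sweeps⇒SweepPerms {A = A} {A′}) ,
    mk⇔ (≃⇒SweepOM {A = A} {A′} ∘ Sweeps⇒≃ {A = A} {A′})
        (≃⇒Sweeps {A = A} {A′} ∘ SweepOM⇒≃ {A = A} {A′}) ,
    mk⇔ (≃⇒BigOM {A = A} {A′} ∘ SweepOM⇒≃ {A = A} {A′}) (BigOM⇒SweepOM {A = A} {A′}) ,
    BigOM⇒LittleOM {A = A} {A′} ∘ ≃⇒BigOM {A = A} {A′} ∘ SweepPerms⇒≃ {A = A} {A′} ,
    BigOM⇒LittleOM {A = A} {A′} ∘ ≃⇒BigOM {A = A} {A′} ∘ Sweeps⇒≃ {A = A} {A′} ,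
    BigOM⇒LittleOM {A = A} {A′} ∘ ≃⇒BigOM {A = A} {A′} ∘ SweepOM⇒≃ {A = A} {A′} ,
    BigOM⇒LittleOM {A = A} {A′}) ,
  4 , 2 , square , trapezoid , fullDim _ , fullDim _ ,
  (square⊆trapezoid , trapezoid⊆square) , sweepPerms-differ
  where
  open Determination K
  open Counterexample K
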